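{- Let $G=(V,E)$ be a graph with $n=|V|$ vertices and $m=|E|$ edges. The algorithm SL-GUMAP, run on $G$ with neighborhood size $k=O(1)$ and sample size exponent $0.9$, runs in $O(n)$ time, where its three components have running times C0: $O(n)$, C1: $O(n)$, C2: $O(n^{0.9})$; and it has space complexity $O(n+m)$.
   Context: SL-GUMAP takes as input a graph $G=(V,E)$ with $n=|V|$, $m=|E|$, a neighborhood size $k$, a sample size exponent (here $0.9$), and a number of iterations $t$, and outputs a drawing of $G$, i.e. an assignment $X$ of a point $X_v\in\mathbb{R}^d$ ($d=2$) to each $v\in V$. C0 and C1 (PartialBFS): for each vertex $v\in V$, perform a breadth-first search of $G$ starting from $v$, recording the distance from $v$ to each visited vertex, and stop once $k$ other vertices have been visited (ties between vertices at equal distance from $v$ are broken at random). The recorded distances form a partial distance matrix (entries not recorded are regarded as infinite), and the pairs $(v,u)$ with $u$ visited in the search from $v$ form the edge set $E_k$ of the $k$-nearest-neighbor graph $G_k=(V,E_k)$, so C0 (distance computation) and C1 ($k$-nearest-neighbor graph computation) are done together and $|E_k|=O(kn)$. An edge between $v_i$ and its neighbor $v_j$ is weighted by $h_{ij}=\exp[-(d_{ij}-\rho_i)/\sigma_i]$, where $d_{ij}$ is the recorded distance, $\rho_i$ is the distance from $v_i$ to its nearest neighbor and $\sigma_i$ is a bandwidth parameter. C2 (GradSample): initialize $X$ by a spectral layout. Shuffle the array $E_k$, set $s=\lfloor |E_k|^{0.9}\rfloor$ and a starting index $j=0$. In each of $t$ iterations, for the (at most $s+1$) edges $(a,b)$ of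 $E_k$ at indices $(j+i)\bmod |E_k|$, $0\le i\le s$, compute $w_{ab}=(1+\alpha\|X_a-X_b\|_2^{2\beta})^{ -1}$ (where $\alpha,\beta>0$ are constants), compute the gradient at $a,b$ (based on $w_{ab}$) of the cost $$C=\sum_{i\ne j}h_{ij}\log\frac{h_{ij}}{w_{ij}}+(1-h_{ij})\log\frac{1-h_{ij}}{1-w_{ij}},$$ and move $X_a,X_b$ based on the gradient; then replace $j$ by $(j+s)\bmod|E_k|$. Conventions: $k$ and $d$ are constants with respect to $n$. The $O(n+m)$ time for reading the input and rendering the output is omitted from running times. The running time of C2 refers to one iteration of the gradient descent (the number $t$ of iterations is treated as a constant, and the initialization is not counted). The overall running time is that of C0, C1 and C2 combined. The space complexity includes storage of the input graph. -}

module Defs where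

open import Data.Bool.Base as Bool using (Bool; T)
open import Data.Fin as Fin using (Fin; toℕ; #_)
import Data.Fin.Properties as Fin
open import Data.List.Base as List
  using (List; []; _∷_; length; mapMaybe; concatMap; allFin; take; foldr; upTo)
open import Data.List.Relation.Unary.All using (All)
open import Data.List.Relation.Unary.Unique.Propositional using (Unique)
open import Data.Maybe.Base using (Maybe; just; nothing)
open import Data.Nat.Base as ℕ using (ℕ; zero; suc; NonZero)
open import Data.Nat.ListAction using (sum)
open import Data.Product.Base using (_×_; _,_; ∃-syntax)
open import Data.Unit.Base using (⊤; tt)
open import Relation.Nullary.Decidable.Core using (⌊_⌋)

-- An undirected edge {a , b} is listed exactly once, as (a , b) with a < b.
record Graph : Set where
  field
    n        : ℕ
    edges    : List (Fin n × Fin n)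
    oriented : All (λ (a , b) → a Fin.< b) edges
    distinct : Unique edges

  m : ℕ
  m = length edges

  opposite : Fin n → Fin n × Fin n → Maybe (Fin n)
  opposite v (a , b) =
    Bool.if ⌊ v Fin.≟ a ⌋ then just b else
    Bool.if ⌊ v Fin.≟ b ⌋ then just a else nothing

  neighbours : Fin n → List (Fin n)
  neighbours v = mapMaybe (opposite v) edges

data Word : Set where
  nat real : Word

-- For each kind of word, memory consists of finitely many infinite arrays.
record Array (w : Word) : Set where
  constructor array
  field
    name : Fin 16

infixr 8 _^_
infixl 7 _*_ _/_ _%_
infixl 6 _+_ _-_
infix  4 _<_ _==_

-- On naturals, subtraction is truncated; comparisons yield 0 or 1.
data Expr (V : Word → Set) : Word → Set where
  var          : ∀ {w} → V w → Expr V w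
  lit          : ℕ → Expr V nat
  _+_ _-_ _*_  : ∀ {w} → Expr V w → Expr V w → Expr V w
  _<_          : ∀ {w} → Expr V w → Expr V w → Expr V nat
  _==_ _%_     : Expr V nat → Expr V nat → Expr V nat
  fromNat      : Expr V nat → Expr V real
  _/_ _^_      : Expr V real → Expr V real → Expr V real
  exp log      : Expr V real → Expr V real
  alpha beta   : Expr V real
  learningRate : Expr V nat → Expr V real

data Type : Set where
  void : Type
  word : Word → Type

-- The value bound by x ← p; a word is bound as a variable, which costs nothing
-- to use again.
Result : (Word → Set) → Type → Set
Result V void     = ⊤
Result V (word w) = Expr V w

infixl 1 _>>=_ _>>_
infix  0 if_then_else_

-- Programs for a random access machine with natural and real words, in
-- parametric higher-order abstract syntax: an algorithm is a program for every
-- V, so it can inspect words only by means of instructions.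
-- `loop e p` runs p 0, p 1, …, p (e - 1), stopping early once one returns 0.
data Prog (V : Word → Set) : Type → Set where
  skip          : Prog V void
  return        : ∀ {w} → Expr V w → Prog V (word w)
  _>>=_         : ∀ {r r′} → Prog V r → (Result V r → Prog V r′) → Prog V r′
  load          : ∀ {w} → Array w → Expr V nat → Prog V (word w)
  store         : ∀ {w} → Array w → Expr V nat → Expr V w → Prog V void
  random        : Expr V nat → Prog V (word nat)
  if_then_else_ : ∀ {r} → Expr V nat → Prog V r → Prog V r → Prog V r
  loop          : Expr V nat → (Expr V nat → Prog V (word nat)) → Prog V void

_>>_ : ∀ {V r r′} → Prog V r → Prog V r′ → Prog V r′
p >> q = p >>= λ _ → q

for : ∀ {V} → Expr V nat → (Expr V nat → Prog V void) → Prog V void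
for e p = loop e λ i → do p i; return (lit 1)

-- Arrays of length one serve as mutable variables.
get : ∀ {V w} → Array w → Prog V (word w)
get a = load a (lit 0)

set : ∀ {V w} → Array w → Expr V w → Prog V void
set a e = store a (lit 0) e

swap : ∀ {V w} → Array w → Expr V nat → Expr V nat → Prog V void
swap a i j = do
  x ← load a i
  y ← load a j
  store a i y
  store a j x

power : ∀ {V} → ℕ → Expr V nat → Expr V nat
power zero    e = lit 1
power (suc k) e = e * power k e

size : ∀ {V w} → Expr V w → ℕ
size (var x)          = 0
size (lit x)          = 1
size (e + f)          = suc (size e ℕ.+ size f)
size (e - f)          = suc (size e ℕ.+ size f)
size (e * f)          = suc (size e ℕ.+ size f)
size (e < f)          = suc (size e ℕ.+ size f)
size (e == f)         = suc (size e ℕ.+ size f)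
size (e % f)          = suc (size e ℕ.+ size f)
size (fromNat e)      = suc (size e)
size (e / f)          = suc (size e ℕ.+ size f)
size (e ^ f)          = suc (size e ℕ.+ size f)
size (exp e)          = suc (size e)
size (log e)          = suc (size e)
size alpha            = 1
size beta             = 1
size (learningRate e) = suc (size e)

-- Registers needed to hold all intermediate results, those of a loop body
-- being reused by each iteration.  Programs have no recursion, so this does
-- not depend on the input.
registers : ∀ {r} → Prog (λ _ → ⊤) r → ℕ
registers skip                 = 0
registers (return e)           = suc (size e)
registers (_>>=_ {r} p q)      = registers p ℕ.+ registers (q (dummy r))
  where
  dummy : ∀ r → Result (λ _ → ⊤) r
  dummy void     = tt
  dummy (word w) = var tt
registers (load a e)           = suc (size e)
registers (store a e f)        = size e ℕ.+ size f
registers (random e)           = suc (size e)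
registers (if e then p else q) = size e ℕ.+ (registers p ℕ.⊔ registers q)
registers (loop e p)           = suc (suc (size e) ℕ.+ registers (p (var tt)))

-- Stands for ℝ.  No law is needed, as running time and space do not depend on
-- the outcome of real arithmetic.
record Reals : Set₁ where
  field
    Carrier             : Set
    fromℕ               : ℕ → Carrier
    add sub mul div pow : Carrier → Carrier → Carrier
    expᴿ logᴿ           : Carrier → Carrier
    less                : Carrier → Carrier → Bool

record Constants (ℛ : Reals) : Set where
  open Reals ℛ
  field
    α β : Carrier
    0<α : T (less (fromℕ 0) α)
    0<β : T (less (fromℕ 0) β)
    η   : ℕ → Carrier

-- The outcome of the i-th random choice, for every number b of alternatives.
Randomness : Set
Randomness = ℕ → (b : ℕ) .{{_ : NonZero b}} → Fin b

module Semantics (ℛ : Reals) (constants : Constants ℛ) (ω : Randomness) where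
  private module R = Reals ℛ
  open Constants constants

  ⟦_⟧ : Word → Set
  ⟦ nat ⟧  = ℕ
  ⟦ real ⟧ = R.Carrier

  boolean : Bool → ℕ
  boolean b = Bool.if b then 1 else 0

  plus minus times : ∀ w → ⟦ w ⟧ → ⟦ w ⟧ → ⟦ w ⟧
  plus  nat  = ℕ._+_
  plus  real = R.add
  minus nat  = ℕ._∸_
  minus real = R.sub
  times nat  = ℕ._*_
  times real = R.mul

  below : ∀ w → ⟦ w ⟧ → ⟦ w ⟧ → Bool
  below nat  = ℕ._<ᵇ_
  below real = R.less

  mod : ℕ → ℕ → ℕ
  mod x zero    = 0
  mod x (suc y) = x ℕ.% suc y

  eval : ∀ {w} → Expr ⟦_⟧ w → ⟦ w ⟧
  eval (var x)          = x
  eval (lit x)          = x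
  eval (_+_ {w} e f)    = plus w (eval e) (eval f)
  eval (_-_ {w} e f)    = minus w (eval e) (eval f)
  eval (_*_ {w} e f)    = times w (eval e) (eval f)
  eval (_<_ {w} e f)    = boolean (below w (eval e) (eval f))
  eval (e == f)         = boolean (eval e ℕ.≡ᵇ eval f)
  eval (e % f)          = mod (eval e) (eval f)
  eval (fromNat e)      = R.fromℕ (eval e)
  eval (e / f)          = R.div (eval e) (eval f)
  eval (e ^ f)          = R.pow (eval e) (eval f)
  eval (exp e)          = R.expᴿ (eval e)
  eval (log e)          = R.logᴿ (eval e)
  eval alpha            = α
  eval beta             = β
  eval (learningRate e) = η (eval e)

  -- extent w a exceeds every index at which array a has been accessed, so that
  -- the sum of all extents is the space used.
  record Memory : Set where
    field
      cell   : ∀ w → Fin 16 → ℕ → ⟦ w ⟧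
      extent : Word → Fin 16 → ℕ
      draws  : ℕ

  open Memory public

  _==ʷ_ : Word → Word → Bool
  nat  ==ʷ nat  = Bool.true
  real ==ʷ real = Bool.true
  _    ==ʷ _    = Bool.false

  touch : ∀ {w} → Array w → ℕ → Memory → Memory
  touch {w} (array a) i μ = record μ { extent = extent′ }
    where
    extent′ : Word → Fin 16 → ℕ
    extent′ w′ a′ =
      Bool.if (w ==ʷ w′) Bool.∧ ⌊ a Fin.≟ a′ ⌋
      then extent μ w a ℕ.⊔ suc i
      else extent μ w′ a′

  update : ∀ w → Fin 16 → ℕ → ⟦ w ⟧ →
           (∀ w → Fin 16 → ℕ → ⟦ w ⟧) → ∀ w → Fin 16 → ℕ → ⟦ w ⟧
  update nat  a i x c nat  a′ i′ =
    Bool.if ⌊ a Fin.≟ a′ ⌋ Bool.∧ (i ℕ.≡ᵇ i′) then x else c nat a′ i′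
  update real a i x c real a′ i′ =
    Bool.if ⌊ a Fin.≟ a′ ⌋ Bool.∧ (i ℕ.≡ᵇ i′) then x else c real a′ i′
  update nat  a i x c real = c real
  update real a i x c nat  = c nat

  write : ∀ {w} → Array w → ℕ → ⟦ w ⟧ → Memory → Memory
  write {w} (array a) i x μ = record μ { cell = update w a i x (cell μ) }

  choose : ℕ → ℕ → ℕ
  choose i zero    = 0
  choose i (suc b) = toℕ (ω i (suc b))

  Value : Type → Set
  Value void     = ⊤
  Value (word w) = ⟦ w ⟧

  bound : ∀ r → Value r → Result ⟦_⟧ r
  bound void     x = x
  bound (word w) x = var x

  record Outcome (r : Type) : Set where
    constructor outcome
    field
      value  : Value r
      memory : Memory
      time   : ℕ

  open Outcome public

  delay : ∀ {r} → ℕ → Outcome r → Outcome r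
  delay t o = record o { time = t ℕ.+ time o }

  andThen : ∀ {r r′} → Outcome r → (Value r → Memory → Outcome r′) → Outcome r′
  andThen o f = delay (time o) (f (value o) (memory o))

  -- One unit of time for each instruction and each operator, and for each
  -- test of a loop's condition.  Unit cost is reasonable since the naturals
  -- that the algorithm computes are bounded by a polynomial in n and m.
  iterate : (ℕ → Memory → Outcome (word nat)) → (fuel i : ℕ) → Memory → Outcome void
  iterate p zero       i μ = outcome tt μ 1
  iterate p (suc fuel) i μ with p i μ
  ... | outcome zero    μ′ t = outcome tt μ′ (suc t)
  ... | outcome (suc _) μ′ t = delay (suc t) (iterate p fuel (suc i) μ′)

  run : ∀ {r} → Prog ⟦_⟧ r → Memory → Outcome r
  run skip μ = outcome tt μ 0
  run (return e) μ = outcome (eval e) μ (suc (size e))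
  run (_>>=_ {r} p q) μ = andThen (run p μ) (λ x → run (q (bound r x)))
  run (load {w} a e) μ =
    outcome (cell μ w (Array.name a) (eval e)) (touch a (eval e) μ) (suc (size e))
  run (store a e f) μ =
    outcome tt (write a (eval e) (eval f) (touch a (eval e) μ)) (suc (size e ℕ.+ size f))
  run (random e) μ =
    outcome (choose (draws μ) (eval e)) (record μ { draws = suc (draws μ) }) (suc (size e))
  run (if e then p else q) μ with eval e
  ... | zero  = delay (suc (size e)) (run q μ)
  ... | suc _ = delay (suc (size e)) (run p μ)
  run (loop e p) μ =
    delay (size e) (iterate (λ i → run (p (var i))) (eval e) 0 μ)

  space : Memory → ℕ
  space μ = sum (List.map (extent μ nat) (allFin 16)) ℕ.+ sum (List.map (extent μ real) (allFin 16))

-- The input: the number of vertices and, in a single array, the adjacency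
-- lists, that of v starting at offset v and ending before offset (v + 1).
order offset adjacency : Array nat
order     = array (# 0)
offset    = array (# 1)
adjacency = array (# 2)

-- The current search: the vertices visited, with their distances.
queue level visited known : Array nat
queue   = array (# 3)
level   = array (# 4)
visited = array (# 5)
known   = array (# 6)

-- The edge set E_k with the recorded distances; the edges from v are those at
-- positions first v, …, first (v + 1) - 1 (until they are shuffled).
edgeCount source target distance first : Array nat
edgeCount = array (# 7)
source    = array (# 8)
target    = array (# 9)
distance  = array (# 10)
first     = array (# 11)

weight : Array real
weight = array (# 0)

bounded : Array nat
bounded = array (# 12)

sigma lower upper accumulator : Array real
sigma       = array (# 1)
lower       = array (# 2)
upper       = array (# 3)
accumulator = array (# 4)

-- The layout: coordinate c of X_v is at position v * d + c.
layout : Array real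
layout = array (# 5)

sampleSize start : Array nat
sampleSize = array (# 13)
start      = array (# 14)

module _ {V : Word → Set} where

  isKnown : Expr V nat → Prog V (word nat)
  isKnown w = do
    set known (lit 0)
    c ← get visited
    loop c λ i → do
      x ← load queue i
      if x == w then set known (lit 1) else skip
      return (lit 1 - (x == w))
    get known

  -- The array queue holds v followed by the other vertices visited.  Each
  -- adjacency list is scanned in random order, which is generated lazily (by
  -- a Fisher-Yates shuffle in place) as far as the scan proceeds.
  search : ℕ → Expr V nat → Prog V void
  search k v = do
    store queue (lit 0) v
    store level (lit 0) (lit 0)
    set visited (lit 1)
    loop (lit (suc k)) λ h → do
      c  ← get visited
      go ← return ((h < c) * (c < lit (suc k)))
      if go then expand h else skip
      return go
    where
    expand : Expr V nat → Prog V void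
    expand h = do
      u  ← load queue h
      δ  ← load level h
      o  ← load offset u
      o′ ← load offset (u + lit 1)
      loop (o′ - o) λ i → do
        r ← random (o′ - o - i)
        swap adjacency (o + i) (o + i + r)
        w ← load adjacency (o + i)
        b ← isKnown w
        if b then skip else do
          c ← get visited
          store queue c w
          store level c (δ + lit 1)
          set visited (c + lit 1)
        c ← get visited
        return (c < lit (suc k))

  record-edges : Expr V nat → Prog V void
  record-edges v = do
    e ← get edgeCount
    c ← get visited
    store first v e
    for (c - lit 1) λ i → do
      u ← load queue (i + lit 1)
      δ ← load level (i + lit 1)
      store source   (e + i) v
      store target   (e + i) u
      store distance (e + i) δ
    set edgeCount (e + (c - lit 1))

  -- C0 and C1
  partialBFS : ℕ → Prog V void
  partialBFS k = do
    n ← get order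
    set edgeCount (lit 0)
    for n λ v → do
      search k v
      record-edges v
    e ← get edgeCount
    store first n e

  -- exp (- (d_ij - ρ_i) / σ_i) for the edge at position e
  membership : Expr V real → Expr V real → Expr V nat → Prog V (word real)
  membership ρ σ e = do
    δ ← load distance e
    return (exp (fromNat (lit 0) - (fromNat δ - ρ) / σ))

  -- As usual in UMAP, the bandwidth σ_i is found by a fixed number of steps of
  -- bisection for the solution of Σ_j exp (- (d_ij - ρ_i) / σ_i) = log₂ k.
  bandwidth : (k steps : ℕ) → (e l : Expr V nat) → Expr V real → Prog V (word real)
  bandwidth k steps e l ρ = do
    goal ← return (log (fromNat (lit k)) / log (fromNat (lit 2)))
    set sigma (fromNat (lit 1))
    set lower (fromNat (lit 0))
    set bounded (lit 0)
    for (lit steps) λ _ → do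
      σ ← get sigma
      set accumulator (fromNat (lit 0))
      for l λ i → do
        h ← membership ρ σ (e + i)
        s ← get accumulator
        set accumulator (s + h)
      s ← get accumulator
      if goal < s then (do set upper σ; set bounded (lit 1)) else set lower σ
      b ← get bounded
      if b
        then (do
          x ← get lower
          y ← get upper
          set sigma ((x + y) / fromNat (lit 2)))
        else set sigma (fromNat (lit 2) * σ)
    get sigma

  -- The weights h_ij of the edges of G_k.  Vertices are visited in order of
  -- distance, so the first edge from v leads to a nearest neighbour.
  weighting : (k steps : ℕ) → Prog V void
  weighting k steps = do
    n ← get order
    for n λ v → do
      e  ← load first v
      e′ ← load first (v + lit 1)
      if e < e′
        then (do
          δ ← load distance e
          ρ ← return (fromNat δ)
          σ ← bandwidth k steps e (e′ - e) ρ
          for (e′ - e) λ i → do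
            h ← membership ρ σ (e + i)
            store weight (e + i) h)
        else skip

  -- C2, preparation: shuffle E_k, let s be the largest number such that
  -- s ^ 10 ≤ ∣E_k∣ ^ 9, and j = 0.
  prepare : Prog V void
  prepare = do
    E ← get edgeCount
    for E λ i → do
      r ← random (E - i)
      swap source   i (i + r)
      swap target   i (i + r)
      swap distance i (i + r)
      swap weight   i (i + r)
    set sampleSize (lit 0)
    loop E λ i → do
      fits ← return (power 10 (i + lit 1) < power 9 E + lit 1)
      if fits then set sampleSize (i + lit 1) else skip
      return fits
    set start (lit 0)

  squaredDistance : ℕ → Expr V nat → Expr V nat → Prog V (word real)
  squaredDistance d a b = do
    set accumulator (fromNat (lit 0))
    for (lit d) λ c → do
      x ← load layout (a * lit d + c)
      y ← load layout (b * lit d + c)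
      s ← get accumulator
      set accumulator (s + (x - y) * (x - y))
    get accumulator

  -- For D = ∥ X_a - X_b ∥² and w = (1 + α D ^ β)⁻¹, the term
  -- h log (h / w) + (1 - h) log ((1 - h) / (1 - w)) of the cost has derivative
  -- (1 - h) / (1 - w) - h / w with respect to w, while the gradient of w is
  -- - 2 α β D ^ (β - 1) w² (X_a - X_b) at a, and the negative of that at b.
  descendAlong : ℕ → Expr V real → Expr V nat → Prog V void
  descendAlong d rate e = do
    a ← load source e
    b ← load target e
    h ← load weight e
    D ← squaredDistance d a b
    w ← return (one / (one + alpha * D ^ beta))
    g ← return (((one - h) / (one - w) - h / w)
                * (zero′ - fromNat (lit 2) * alpha * beta * D ^ (beta - one) * w * w))
    for (lit d) λ c → do
      x ← load layout (a * lit d + c)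
      y ← load layout (b * lit d + c)
      γ ← return (g * (x - y))
      store layout (a * lit d + c) (x - rate * γ)
      store layout (b * lit d + c) (y + rate * γ)
    where
    zero′ one : Expr V real
    zero′ = fromNat (lit 0)
    one   = fromNat (lit 1)

  -- One iteration of C2
  gradSample : ℕ → Expr V nat → Prog V void
  gradSample d round = do
    E ← get edgeCount
    s ← get sampleSize
    j ← get start
    rate ← return (learningRate round)
    if E
      then (do
        for (s + lit 1) λ i → descendAlong d rate ((j + i) % E)
        set start ((j + s) % E))
      else skip

  gradSamples : ℕ → ℕ → Prog V void
  gradSamples d rounds = for (lit rounds) (gradSample d)

-- The parameters treated as constants: the dimension d, the number t of
-- iterations, the number of bisection steps, and an upper bound for k.
module SL-GUMAP
  (ℛ : Reals) (constants : Constants ℛ) (d t steps kmax : ℕ) where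

  -- A run is determined by the graph, the neighbourhood size, the random
  -- choices and the initial (spectral) layout, which may be any layout
  -- whatsoever, since its computation is not accounted for.
  record Instance : Set where
    field
      graph   : Graph
      k       : ℕ
      k≤kmax  : k ℕ.≤ kmax
      ω       : Randomness
      initial : ℕ → Reals.Carrier ℛ

    open Graph graph public using (n; m)
    open Graph graph using (neighbours)
    open Semantics ℛ constants ω

    offsetOf : ℕ → ℕ
    offsetOf v = sum (take v (List.map (λ u → length (neighbours u)) (allFin n)))

    adjacencies : List ℕ
    adjacencies = concatMap (λ u → List.map toℕ (neighbours u)) (allFin n)

    at : List ℕ → ℕ → ℕ
    at []       i       = 0
    at (x ∷ xs) zero    = x
    at (x ∷ xs) (suc i) = at xs i

    input : Memory
    input = record { cell = cells ; extent = extents ; draws = 0 }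
      where
      cells : ∀ w → Fin 16 → ℕ → ⟦ w ⟧
      cells nat  Fin.zero                         i = n
      cells nat  (Fin.suc Fin.zero)               i = offsetOf i
      cells nat  (Fin.suc (Fin.suc Fin.zero))     i = at adjacencies i
      cells nat  (Fin.suc (Fin.suc (Fin.suc _)))  i = 0
      cells real _                                i = Reals.fromℕ ℛ 0

      extents : Word → Fin 16 → ℕ
      extents nat  Fin.zero                        = 1
      extents nat  (Fin.suc Fin.zero)              = suc n
      extents nat  (Fin.suc (Fin.suc Fin.zero))    = length adjacencies
      extents nat  (Fin.suc (Fin.suc (Fin.suc _))) = 0
      extents real _                               = 0

    initialize : Memory → Memory
    initialize μ = record μ
      { cell   = cells
      ; extent = extents
      }
      where
      cells : ∀ w → Fin 16 → ℕ → ⟦ w ⟧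
      cells nat  a i = cell μ nat a i
      cells real a i =
        Bool.if ⌊ a Fin.≟ Array.name layout ⌋ then initial i else cell μ real a i

      extents : Word → Fin 16 → ℕ
      extents nat  a = extent μ nat a
      extents real a =
        Bool.if ⌊ a Fin.≟ Array.name layout ⌋ then n ℕ.* d else extent μ real a

    searched weighted prepared : Outcome void
    searched = run (partialBFS k) input
    weighted = run (weighting k steps) (memory searched)
    prepared = run prepare (initialize (memory weighted))

    -- The first i iterations, and the next one.
    descended : ℕ → Outcome void
    descended i = run (gradSamples d i) (memory prepared)

    round : ℕ → Outcome void
    round i = run (gradSample d (lit i)) (memory (descended i))

    -- The distances and the edges of G_k are computed by the same searches.
    time-C0 time-C1 time-C2 totalTime totalSpace : ℕ
    time-C0    = time searched
    time-C1    = time searched ℕ.+ time weighted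
    time-C2    = foldr ℕ._⊔_ 0 (List.map (λ i → time (round i)) (upTo t))
    totalTime  = time searched ℕ.+ time weighted ℕ.+ time prepared ℕ.+ time (descended t)
    totalSpace = space (memory (descended t))
                 ℕ.+ registers (partialBFS k) ℕ.+ registers (weighting k steps)
                 ℕ.+ registers prepare ℕ.+ registers (gradSamples d t)

  open Instance public

  infix 4 _=O[_] _=O[_]^[_/_]

  -- f = O (g ^ (p / q)), where natural powers avoid the root
  _=O[_]^[_/_] : (Instance → ℕ) → (Instance → ℕ) → ℕ → ℕ → Set
  f =O[ g ]^[ p / q ] =
    ∃[ C ] ∃[ n₀ ] ∀ x → n₀ ℕ.≤ n x → f x ℕ.^ q ℕ.≤ C ℕ.^ q ℕ.* g x ℕ.^ p

  _=O[_] : (Instance → ℕ) → (Instance → ℕ) → Set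
  f =O[ g ] = ∃[ C ] ∃[ n₀ ] ∀ x → n₀ ℕ.≤ n x → f x ℕ.≤ C ℕ.* g x

-- The search from v expands vertices of its queue, which never holds more than
-- k + 1 vertices.  Expanding u scans its adjacency list in random order; since
-- the graph is simple, the neighbours scanned are distinct, and each of them is
-- in the queue after having been scanned.  Hence at most k + 1 of them are
-- scanned, whatever the degree of u, and a search takes time O(k³).  So C0 and
-- C1 take time O(n), and they yield E ≤ k n edges.  An iteration of C2 then
-- visits s + 1 edges, where s ^ 10 ≤ E ^ 9.
--
-- Time, the extents of all arrays, and the invariants needed are tracked
-- together by a calculus of weakest preconditions.

module Submission where

open import Defs
  hiding (if_then_else_; _>>=_; _>>_; _+_; _-_; _*_; _/_; _%_; _^_; _<_; _==_)
open import Data.Bool.Base using (true; false; T; if_then_else_)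
open import Data.Fin.Base as Fin using (Fin; toℕ; fromℕ<)
import Data.Fin.Properties as Fin
open import Data.List.Base as List
  using (List; []; _∷_; _++_; length; mapMaybe; concat; take; allFin; upTo; foldr)
open import Data.List.Properties using (length-map; length-++; map-cong; map-∘)
open import Data.List.Relation.Unary.All as All using (All; []; _∷_)
import Data.List.Relation.Unary.All.Properties as All
open import Data.List.Relation.Unary.AllPairs using ([]; _∷_)
open import Data.List.Relation.Unary.Unique.Propositional using (Unique)
import Data.List.Relation.Unary.Unique.Propositional.Properties as Unique
open import Data.Maybe.Base using (Maybe; just; nothing)
open import Data.Maybe.Properties using (just-injective)
open import Data.Nat.Base
open import Data.Nat.DivMod using (m%n<n)
open import Data.Nat.ListAction using (sum)
open import Data.Nat.Properties
open import Data.Nat.Solver using (module +-*-Solver)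
open import Data.Product.Base using (_×_; _,_; proj₂; map)
open import Data.Sum.Base using (inj₁; inj₂)
open import Data.Unit.Base using (tt)
open import Data.Vec.Base as Vec using ([]; _∷_)
open import Data.Vec.Relation.Unary.All using ([]; _∷_)
import Data.Vec.Relation.Unary.All.Properties as Vec
open import Function.Base using (_∘_; const; id)
open import Relation.Binary.Definitions using (tri<; tri≈; tri>)
open import Relation.Binary.PropositionalEquality
open import Relation.Nullary using (yes; no; contradiction)

-- Weakest preconditions

-- A loop may be entered with a bound that no constant controls, namely the degree of the vertex
-- expanded, so the loop rule cannot charge for the bound that the program states. `looping` instead
-- takes a number `m` such that the invariant at iteration `i` implies `i < m`, and charges for `m`
-- iterations; the counting argument thereby becomes an ordinary consequence of an invariant. The
-- second obstacle is that the shuffle is in place: each search leaves the adjacency lists permuted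
-- for the next one, so the invariants cannot mention the lists of the graph. They retain the fixed
-- offsets, the range of the entries, and that no list repeats an entry, all of which survive
-- permuting a list. Postconditions see only a value and the cells; random outcomes are quantified
-- over, and extents are compared with a fixed `limit`. Times are stated with the constant `K` in
-- place of the `k` of an instance, so that the factors found serve all instances at once.

module WeakestPreconditions
  (ℛ : Reals) (constants : Constants ℛ) (ω : Randomness)
  (limit : Word → Fin 16 → ℕ) where

  open Semantics ℛ constants ω

  Cells : Set
  Cells = ∀ w → Fin 16 → ℕ → ⟦ w ⟧

  Post : Type → Set₁
  Post r = Value r → Cells → Set

  Within : (Word → Fin 16 → ℕ) → Set
  Within extents = ∀ w a → extents w a ≤ limit w a

  record Meets {r} (t : ℕ) (Q : Post r) (o : Outcome r) : Set where
    constructor meets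
    field
      time≤    : time o ≤ t
      extents≤ : Within (extent (memory o))
      result   : Q (value o) (cell (memory o))

  open Meets public

  record WP {r} (c : Cells) (p : Prog ⟦_⟧ r) (t : ℕ) (Q : Post r) : Set where
    field
      execute : ∀ {x i} → Within x → Meets t Q (run p (record { cell = c ; extent = x ; draws = i }))

  open WP

  private variable
    r r′    : Type
    w       : Word
    c       : Cells
    t t₁ t₂ : ℕ
    A       : Set

  executing : ∀ (p : Prog ⟦_⟧ r) {Q : Post r} μ → WP (cell μ) p t Q → Within (extent μ) → Meets t Q (run p μ)
  executing p μ s within = s .execute within

  relax : {p : Prog ⟦_⟧ r} {Q : Post r} → WP c p t₁ Q → t₁ ≤ t → WP c p t Q
  relax s t₁≤t .execute within .time≤    = ≤-trans (s .execute within .time≤) t₁≤t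
  relax s t₁≤t .execute within .extents≤ = s .execute within .extents≤
  relax s t₁≤t .execute within .result   = s .execute within .result

  infixl 1 _>>=_ _>>_

  _>>=_ : ∀ {p : Prog ⟦_⟧ r} {R : Post r} {Q : Post r′} {q : Result ⟦_⟧ r → Prog ⟦_⟧ r′} →
          WP c p t₁ R → (∀ {x c′} → R x c′ → WP c′ (q (bound r x)) t₂ Q) →
          WP c (p Prog.>>= q) (t₁ + t₂) Q
  (s >>= k) .execute within =
    let meets t₁≤ within′ z = s .execute within
        meets t₂≤ within″ z′ = k z .execute within′
    in meets (+-mono-≤ t₁≤ t₂≤) within″ z′

  -- For the rules whose last argument is what remains to be shown after the instruction.
  _>>_ : ∀ {p : Prog ⟦_⟧ r} {Q : Post r′} {q : Result ⟦_⟧ r → Prog ⟦_⟧ r′} →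
         (A → WP c p t₁ (λ x c′ → WP c′ (q (bound r x)) t₂ Q)) → A →
         WP c (p Prog.>>= q) (t₁ + t₂) Q
  s >> k = s k >>= id

  touch-within : ∀ {w} (a : Array w) {i μ} → i < limit w (Array.name a) →
                 Within (extent μ) → Within (extent (touch a i μ))
  touch-within {nat}  (array a) i< within nat a′ with a Fin.≟ a′
  ... | yes refl = ⊔-lub (within nat a) i<
  ... | no  _    = within nat a′
  touch-within {real} (array a) i< within real a′ with a Fin.≟ a′
  ... | yes refl = ⊔-lub (within real a) i<
  ... | no  _    = within real a′
  touch-within {nat}  (array a) i< within real a′ = within real a′
  touch-within {real} (array a) i< within nat  a′ = within nat  a′

  skipping : {Q : Post void} → Q tt c → WP c skip 0 Q
  skipping q .execute within = meets ≤-refl within q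

  returning : ∀ {e : Expr ⟦_⟧ w} {Q : Post (word w)} → Q (eval e) c → WP c (return e) (suc (size e)) Q
  returning q .execute within = meets ≤-refl within q

  -- x is typically a value known from an invariant, free of the current memory.
  loading : ∀ {a : Array w} {e : Expr ⟦_⟧ nat} {x : ⟦ w ⟧} {Q : Post (word w)} →
            eval e < limit w (Array.name a) → c w (Array.name a) (eval e) ≡ x →
            Q x c → WP c (load a e) (suc (size e)) Q
  loading {c = c} {a = a} i< refl q .execute {x} {i} within =
    meets ≤-refl (touch-within a {μ = record { cell = c ; extent = x ; draws = i }} i< within) q

  storing : ∀ {a : Array w} {e : Expr ⟦_⟧ nat} {f : Expr ⟦_⟧ w} {Q : Post void} →
            eval e < limit w (Array.name a) →
            Q tt (update w (Array.name a) (eval e) (eval f) c) →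
            WP c (store a e f) (suc (size e + size f)) Q
  storing {c = c} {a = a} i< q .execute {x} {i} within =
    meets ≤-refl (touch-within a {μ = record { cell = c ; extent = x ; draws = i }} i< within) q

  choose< : ∀ i b → 0 < b → choose i b < b
  choose< i (suc b) _ = Fin.toℕ<n (ω i (suc b))

  -- The outcome is known only by its range, so what follows has to bind it; matching the equation
  -- with `refl` resumes with the old cells.
  drawing : ∀ {e : Expr ⟦_⟧ nat} → 0 < eval e →
            WP c (random e) (suc (size e)) (λ x c′ → x < eval e × c′ ≡ c)
  drawing 0<b .execute {i = i} within = meets ≤-refl within (choose< i _ 0<b , refl)

  -- Charging for both branches instead of the longer one keeps every time a plain sum, and a branch
  -- that is `skip` adds 0.
  branching : ∀ {p₁ p₂ : Prog ⟦_⟧ r} {Q : Post r} {e : Expr ⟦_⟧ nat} →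
              (eval e ≢ 0 → WP c p₁ t₁ Q) → (eval e ≡ 0 → WP c p₂ t₂ Q) →
              WP c (Prog.if_then_else_ e p₁ p₂) (suc (size e + (t₁ + t₂))) Q
  branching {t₁ = t₁} {t₂ = t₂} {e = e} s₁ s₂ .execute within with eval e
  ... | zero  = let meets t≤ within′ q = s₂ refl .execute within
                in meets (s≤s (+-monoʳ-≤ (size e) (m≤n⇒m≤o+n t₁ t≤))) within′ q
  ... | suc _ = let meets t≤ within′ q = s₁ (λ ()) .execute within
                in meets (s≤s (+-monoʳ-≤ (size e) (m≤n⇒m≤n+o t₂ t≤))) within′ q

  module _ {P : ℕ → Prog ⟦_⟧ (word nat)} {n : ℕ} (I : ℕ → Cells → Set) (R : Cells → Set)
           (m : ℕ) (i<m : ∀ {i c} → i < n → I i c → i < m)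
           (step : ∀ {i c} → i < n → I i c →
                   WP c (P i) t (λ x c′ → (x ≢ 0 → I (suc i) c′) × (x ≡ 0 → R c′)))
           (end : ∀ {c} → I n c → R c) where

    -- Iteration `i` is paid from the budget of `m ∸ i` iterations, which is positive by `i<m`; `u`
    -- is the cost of what remains of the loop.
    later : ∀ {i t′ u} → i < m → t′ ≤ t → u ≤ suc ((m ∸ suc i) * suc t) →
            suc t′ + u ≤ suc ((m ∸ i) * suc t)
    later {i} {t′} {u} i<m t′≤t u≤ = begin
      suc t′ + u                              ≤⟨ +-mono-≤ (s≤s t′≤t) u≤ ⟩
      suc t + suc ((m ∸ suc i) * suc t)       ≡⟨ +-suc (suc t) _ ⟩
      suc (suc (m ∸ suc i) * suc t)           ≡⟨ cong (λ l → suc (l * suc t)) (+-∸-assoc 1 i<m) ⟨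
      suc ((m ∸ i) * suc t)                   ∎
      where open ≤-Reasoning

    iterating : ∀ f i {c x d} → f + i ≡ n → I i c → Within x →
                Meets (suc ((m ∸ i) * suc t)) (const R)
                      (iterate (run ∘ P) f i (record { cell = c ; extent = x ; draws = d }))
    iterating zero i refl inv within = meets (s≤s z≤n) within (end inv)
    iterating (suc f) i {c} {x} {d} f+i≡n inv within
      with i<n ← ≤-trans (m≤n+m (suc i) f) (≤-reflexive (trans (+-suc f i) f+i≡n))
      with run (P i) (record { cell = c ; extent = x ; draws = d })
         | step i<n inv .execute {i = d} within
    ... | outcome zero    μ t′ | meets t′≤t within′ (_ , stop) =
      -- An early stop saves the final test, so `later` is used with `u = 1` and that unit is
      -- dropped.
      meets (≤-trans (m≤m+n (suc t′) 1) (later (i<m i<n inv) t′≤t (s≤s z≤n)))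
            within′ (stop refl)
    ... | outcome (suc _) μ t′ | meets t′≤t within′ (continue , _) =
      let meets u≤ within″ r = iterating f (suc i) (trans (+-suc f i) f+i≡n) (continue (λ ())) within′
      in meets (later (i<m i<n inv) t′≤t u≤) within″ r

  looping : ∀ {e : Expr ⟦_⟧ nat} {P : Expr ⟦_⟧ nat → Prog ⟦_⟧ (word nat)}
            (I : ℕ → Cells → Set) (R : Cells → Set) (m : ℕ) →
            (∀ {i c} → i < eval e → I i c → i < m) →
            I 0 c →
            (∀ {c} → I (eval e) c → R c) →
            (∀ {i c} → i < eval e → I i c →
             WP c (P (var i)) t (λ x c′ → (x ≢ 0 → I (suc i) c′) × (x ≡ 0 → R c′))) →
            WP c (loop e P) (size e + suc (m * suc t)) (λ _ → R)
  looping {e = e} I R m i<m start end step .execute within =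
    let meets t≤ within′ r = iterating I R m i<m step end (eval e) 0 (+-identityʳ _) start within
    in meets (+-monoʳ-≤ (size e) t≤) within′ r

  -- `for` closes its body with `return (lit 1)`, which costs the additional 2 and never stops the
  -- loop.
  counting : ∀ {e : Expr ⟦_⟧ nat} {P : Expr ⟦_⟧ nat → Prog ⟦_⟧ void}
             (I : ℕ → Cells → Set) (m : ℕ) → eval e ≤ m →
             I 0 c →
             (∀ {i c} → i < eval e → I i c → WP c (P (var i)) t (λ _ → I (suc i))) →
             WP c (for e P) (size e + suc (m * suc (t + 2))) (λ _ → I (eval e))
  counting {e = e} I m ≤m start step =
    looping I (I (eval e)) m (λ i<e _ → <-≤-trans i<e ≤m) start id
      (λ i<e inv → step i<e inv >>= λ inv′ → returning ((λ _ → inv′) , λ ()))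

-- Invariants

-- Invariants are stated about the contents of single arrays, so that an
-- assignment to one array leaves those about the others unchanged by definition.
Row : Set
Row = ℕ → ℕ

_[_≔_] : ∀ {A : Set} → (ℕ → A) → ℕ → A → ℕ → A
(f [ i ≔ x ]) j = if i ≡ᵇ j then x else f j

assigned-elim : ∀ {A : Set} (P : A → Set) (f : ℕ → A) i x j →
                (i ≡ j → P x) → (i ≢ j → P (f j)) → P ((f [ i ≔ x ]) j)
assigned-elim P f i x j here there with i ≡ᵇ j in eq
... | true  = here (≡ᵇ⇒≡ i j (subst T (sym eq) tt))
... | false = there λ i≡j → subst T eq (≡⇒≡ᵇ i j i≡j)

assigned-here : ∀ {A : Set} (f : ℕ → A) i x → (f [ i ≔ x ]) i ≡ x
assigned-here f i x = assigned-elim (_≡ x) f i x i (λ _ → refl) (contradiction refl)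

assigned-there : ∀ {A : Set} (f : ℕ → A) {i} x {j} → i ≢ j → (f [ i ≔ x ]) j ≡ f j
assigned-there f {i} x {j} i≢j = assigned-elim (_≡ f j) f i x j (λ i≡j → contradiction i≡j i≢j) (λ _ → refl)

-- Transpositions of array entries

transpose : ℕ → ℕ → ℕ → ℕ
transpose i j = (id [ i ≔ j ]) [ j ≔ i ]

-- The contents left by the two stores of `swap`, in the form to which `update` reduces;
-- `transposed≡` trades it for precomposition with a permutation.
transposed : Row → ℕ → ℕ → Row
transposed f i j = (f [ i ≔ f j ]) [ j ≔ f i ]

transposed≡ : ∀ f i j x → transposed f i j x ≡ f (transpose i j x)
transposed≡ f i j x with j ≡ᵇ x | i ≡ᵇ x
... | true  | _     = refl
... | false | true  = refl
... | false | false = refl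

data Transposes (i j : ℕ) : ℕ → ℕ → Set where
  left  : Transposes i j i j
  right : Transposes i j j i
  fixed : ∀ {x} → i ≢ x → j ≢ x → Transposes i j x x

transposes : ∀ i j x → Transposes i j x (transpose i j x)
transposes i j x = assigned-elim (Transposes i j x) (id [ i ≔ j ]) j i x
  (λ { refl → right })
  (λ j≢x → assigned-elim (Transposes i j x) id i j x (λ { refl → left }) (λ i≢x → fixed i≢x j≢x))

transpose-preserves : ∀ (P : ℕ → Set) {i j x} → P i → P j → P x → P (transpose i j x)
transpose-preserves P {i} {j} {x} pi pj px with transpose i j x | transposes i j x
... | _ | left      = pj
... | _ | right     = pi
... | _ | fixed _ _ = px

transpose-injective : ∀ i j x y → transpose i j x ≡ transpose i j y → x ≡ y
transpose-injective i j x y eq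
  with transpose i j x | transposes i j x | transpose i j y | transposes i j y
... | _ | left      | _ | left      = refl
... | _ | left      | _ | right     = sym eq
... | _ | left      | _ | fixed _ q = contradiction eq q
... | _ | right     | _ | left      = sym eq
... | _ | right     | _ | right     = refl
... | _ | right     | _ | fixed p _ = contradiction eq p
... | _ | fixed _ q | _ | left      = contradiction (sym eq) q
... | _ | fixed p _ | _ | right     = contradiction (sym eq) p
... | _ | fixed _ _ | _ | fixed _ _ = eq

boolean≢0 : ∀ b → (if b then 1 else 0) ≢ 0 → b ≡ true
boolean≢0 true  _ = refl
boolean≢0 false p = contradiction refl p

-- Invariants of the search and of the edge list

module Invariants (n k L : ℕ) (off : ℕ → ℕ)
  (off≤ : ∀ u → off u ≤ off (suc u)) (off≤L : ∀ u → off u ≤ L) where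

  InSegment : ℕ → ℕ → Set
  InSegment u i = off u ≤ i × i < off (suc u)

  record Adjacency (order offset adjacency : Row) : Set where
    field
      order≡    : order 0 ≡ n
      offset≡   : ∀ u → offset u ≡ off u
      below     : ∀ {i} → i < L → adjacency i < n
      separated : ∀ u {i j} → InSegment u i → InSegment u j → adjacency i ≡ adjacency j → i ≡ j

  off-mono : ∀ {u v} → u ≤ v → off u ≤ off v
  off-mono {u} {v} u≤v = go (≤⇒≤′ u≤v)
    where
    go : ∀ {v} → u ≤′ v → off u ≤ off v
    go ≤′-refl       = ≤-refl
    go (≤′-step u≤v) = ≤-trans (go u≤v) (off≤ _)

  segment-unique : ∀ {u v i} → InSegment u i → InSegment v i → u ≡ v
  segment-unique {u} {v} (u≤i , i<u) (v≤i , i<v) with <-cmp u v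
  ... | tri≈ _ u≡v _ = u≡v
  ... | tri< u<v _ _ = contradiction (<-≤-trans i<u (≤-trans (off-mono u<v) v≤i)) (<-irrefl refl)
  ... | tri> _ _ v<u = contradiction (<-≤-trans i<v (≤-trans (off-mono v<u) u≤i)) (<-irrefl refl)

  segment<L : ∀ {u i} → InSegment u i → i < L
  segment<L (_ , i<) = <-≤-trans i< (off≤L _)

  -- Segments are disjoint, so one that contains either swapped position is that of `u` and contains
  -- the other as well. The transposition thus maps every segment into itself, and being injective
  -- it keeps the entries there distinct.
  swap-adjacency : ∀ {order offset adjacency u i j} → InSegment u i → InSegment u j →
                   Adjacency order offset adjacency → Adjacency order offset (transposed adjacency i j)
  swap-adjacency {adjacency = adjacency} {u} {i} {j} i∈u j∈u inv = record
    { order≡    = order≡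
    ; offset≡   = offset≡
    ; below     = λ {x} x<L → subst (_< n) (sym (transposed≡ adjacency i j x))
                    (below (transpose-preserves (_< L) (segment<L i∈u) (segment<L j∈u) x<L))
    ; separated = λ v {x} {y} x∈v y∈v eq → transpose-injective i j x y
                    (separated v (stays x∈v) (stays y∈v)
                      (trans (sym (transposed≡ adjacency i j x)) (trans eq (transposed≡ adjacency i j y))))
    }
    where
    open Adjacency inv
    stays : ∀ {v x} → InSegment v x → InSegment v (transpose i j x)
    stays {v} {x} x∈v with transpose i j x | transposes i j x
    ... | _ | left      = subst (λ v → InSegment v j) (segment-unique i∈u x∈v) j∈u
    ... | _ | right     = subst (λ v → InSegment v i) (segment-unique j∈u x∈v) i∈u
    ... | _ | fixed _ _ = x∈v

  -- The bound `b` is `k` while there must be room for one more vertex, and `suc k` in general.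
  record Queue (b : ℕ) (queue visited : Row) : Set where
    field
      visited≤ : visited 0 ≤ b
      queue<   : ∀ {q} → q < visited 0 → queue q < n

  record Queued (queue visited : Row) (w : ℕ) : Set where
    constructor queued
    field
      {position} : ℕ
      position<  : position < visited 0
      found      : queue position ≡ w

  record Scanned (u i : ℕ) (adjacency queue visited : Row) : Set where
    constructor scanned
    field
      enqueued : ∀ {j} → j < i → Queued queue visited (adjacency (off u + j))

  in-segment : ∀ {u i} → i < off (suc u) ∸ off u → InSegment u (off u + i)
  in-segment {u} {i} i< = m≤m+n (off u) i ,
    subst (off u + i <_) (m+[n∸m]≡n (off≤ u)) (+-monoʳ-< (off u) i<)

  shifted : ∀ {u i r} → i < off (suc u) ∸ off u → r < off (suc u) ∸ off u ∸ i → InSegment u (off u + i + r)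
  shifted {u} {i} {r} i< r< = subst (InSegment u) (sym (+-assoc (off u) i r))
    (in-segment (subst (i + r <_) (m+[n∸m]≡n (<⇒≤ i<)) (+-monoʳ-< i r<)))

  -- The neighbours scanned so far are distinct, and they are all in the queue.
  scanned≤visited : ∀ {order offset adjacency queue visited u i} → Adjacency order offset adjacency →
                    Scanned u i adjacency queue visited → i ≤ off (suc u) ∸ off u → i ≤ visited 0
  scanned≤visited {adjacency = adjacency} {queue} {visited} {u} {i} inv (scanned enqueued) i≤ =
    Fin.injective⇒≤ {f = place} λ {j} {j′} eq →
      Fin.toℕ-injective (+-cancelˡ-≡ (off u) _ _ (separated u (inside j) (inside j′) (begin
        adjacency (off u + toℕ j)          ≡⟨ found (entry j) ⟨
        queue (position (entry j))         ≡⟨ cong queue (Fin.toℕ-fromℕ< (position< (entry j))) ⟨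
        queue (toℕ (place j))              ≡⟨ cong (queue ∘ toℕ) eq ⟩
        queue (toℕ (place j′))             ≡⟨ cong queue (Fin.toℕ-fromℕ< (position< (entry j′))) ⟩
        queue (position (entry j′))        ≡⟨ found (entry j′) ⟩
        adjacency (off u + toℕ j′)         ∎)))
    where
    open Adjacency inv
    open Queued
    open ≡-Reasoning
    inside : ∀ (j : Fin i) → InSegment u (off u + toℕ j)
    inside j = in-segment (<-≤-trans (Fin.toℕ<n j) i≤)
    entry : ∀ (j : Fin i) → Queued queue visited (adjacency (off u + toℕ j))
    entry j = enqueued (Fin.toℕ<n j)
    place : Fin i → Fin (visited 0)
    place j = fromℕ< (position< (entry j))

  -- A Fisher-Yates step swaps positions from `off u + i` onwards, which all lie after those already
  -- scanned.
  swap-scanned : ∀ {u i r adjacency queue visited} → Scanned u i adjacency queue visited →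
                 Scanned u i (transposed adjacency (off u + i) (off u + i + r)) queue visited
  swap-scanned {u} {i} {r} {adjacency} {queue} {visited} (scanned enqueued) = scanned λ {j} j<i →
    let below : off u + j < off u + i
        below = +-monoʳ-< (off u) j<i
    in subst (Queued queue visited)
      (sym (trans (assigned-there (adjacency [ off u + i ≔ adjacency (off u + i + r) ]) (adjacency (off u + i))
                                  (>⇒≢ (<-≤-trans below (m≤m+n _ r))))
                  (assigned-there adjacency (adjacency (off u + i + r)) (>⇒≢ below))))
      (enqueued j<i)

  scan : ∀ {u i adjacency queue visited} → Scanned u i adjacency queue visited →
         Queued queue visited (adjacency (off u + i)) → Scanned u (suc i) adjacency queue visited
  scan {u} {i} {adjacency} {queue} {visited} (scanned enqueued) now = scanned extended
    where
    extended : ∀ {j} → j < suc i → Queued queue visited (adjacency (off u + j))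
    extended j≤i with m≤n⇒m<n∨m≡n (s≤s⁻¹ j≤i)
    ... | inj₁ j<i  = enqueued j<i
    ... | inj₂ refl = now

  module _ {queue visited : Row} {w : ℕ} where
    private
      queue′ visited′ : Row
      queue′   = queue [ visited 0 ≔ w ]
      visited′ = visited [ 0 ≔ visited 0 + 1 ]

      extended : visited′ 0 ≡ suc (visited 0)
      extended = +-comm (visited 0) 1

    enqueue : ∀ {b} → w < n → Queue b queue visited → Queue (suc b) queue′ visited′
    enqueue w<n inv = record
      { visited≤ = ≤-trans (≤-reflexive extended) (s≤s visited≤)
      ; queue<   = λ {q} q< → assigned-elim (_< n) queue (visited 0) w q (λ _ → w<n)
                     (λ ≢q → queue< (≤∧≢⇒< (s≤s⁻¹ (≤-trans q< (≤-reflexive extended))) (≢q ∘ sym)))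
      }
      where open Queue inv

    still-queued : ∀ {x} → Queued queue visited x → Queued queue′ visited′ x
    still-queued (queued q< eq) =
      queued (≤-trans q< (m≤m+n _ 1)) (trans (assigned-there queue w (>⇒≢ q<)) eq)

    now-queued : Queued queue′ visited′ w
    now-queued = queued (≤-reflexive (sym extended)) (assigned-here queue (visited 0) w)

    still-scanned : ∀ {u i adjacency} → Scanned u i adjacency queue visited →
                    Scanned u i adjacency queue′ visited′
    still-scanned (scanned enqueued) = scanned (still-queued ∘ enqueued)

  -- The two arrays are bounded separately, so that the shuffle can swap entries of one before those
  -- of the other without breaking the invariant.
  record Endpoints (e : ℕ) (source target : Row) : Set where
    constructor endpoints
    field
      source< : ∀ {p} → p < e → source p < n
      target< : ∀ {p} → p < e → target p < n

  recount : ∀ {e e′ source target} → e ≡ e′ → Endpoints e source target → Endpoints e′ source target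
  recount refl ends = ends

  swap-source : ∀ {e source target i j} → i < e → j < e → Endpoints e source target →
                Endpoints e (transposed source i j) target
  swap-source {e} {source} {i = i} {j} i<e j<e (endpoints source< target<) = endpoints
    (λ {p} p<e → subst (_< n) (sym (transposed≡ source i j p)) (source< (transpose-preserves (_< e) i<e j<e p<e)))
    target<

  swap-target : ∀ {e source target i j} → i < e → j < e → Endpoints e source target →
                Endpoints e source (transposed target i j)
  swap-target {e} {target = target} {i} {j} i<e j<e (endpoints source< target<) = endpoints source<
    (λ {p} p<e → subst (_< n) (sym (transposed≡ target i j p)) (target< (transpose-preserves (_< e) i<e j<e p<e)))

  new-endpoints : ∀ {e source target a b} → a < n → b < n → Endpoints e source target →
                  Endpoints (suc e) (source [ e ≔ a ]) (target [ e ≔ b ])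
  new-endpoints {e} {source} {target} {a} {b} a<n b<n (endpoints source< target<) = endpoints
    (λ {p} p≤e → assigned-elim (_< n) source e a p (λ _ → a<n) (λ e≢p → source< (p<e p≤e e≢p)))
    (λ {p} p≤e → assigned-elim (_< n) target e b p (λ _ → b<n) (λ e≢p → target< (p<e p≤e e≢p)))
    where
    p<e : ∀ {p} → p < suc e → e ≢ p → p < e
    p<e p≤e e≢p = ≤∧≢⇒< (s≤s⁻¹ p≤e) (e≢p ∘ sym)

  -- As long as `first v` is not stored, the edges of the vertex before `v` end at the count `e`:
  -- this is `last≤`, which `next-firsts` turns into an instance of `step≤`.
  record Firsts (v e : ℕ) (first : Row) : Set where
    field
      count≤ : e ≤ k * v
      first≤ : ∀ {u} → u < v → first u ≤ k * u
      step≤  : ∀ {u} → suc u < v → first (suc u) ≤ first u + k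
      last≤  : ∀ {u} → suc u ≡ v → e ≤ first u + k

  next-firsts : ∀ {v e l first} → l ≤ k → Firsts v e first → Firsts (suc v) (e + l) (first [ v ≔ e ])
  next-firsts {v} {e} {l} {first} l≤k inv = record
    { count≤ = ≤-trans (+-mono-≤ count≤ l≤k) (≤-reflexive (trans (+-comm (k * v) k) (sym (*-suc k v))))
    ; first≤ = λ {u} u≤v → assigned-elim (_≤ k * u) first v e u
                 (λ { refl → count≤ }) (λ v≢u → first≤ (≤∧≢⇒< (s≤s⁻¹ u≤v) (v≢u ∘ sym)))
    ; step≤  = λ {u} u<v → subst (λ x → (first [ v ≔ e ]) (suc u) ≤ x + k)
                 (sym (assigned-there first e (>⇒≢ (s≤s⁻¹ u<v))))
                 (assigned-elim (_≤ first u + k) first v e (suc u)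
                   (λ eq → last≤ (sym eq)) (λ v≢ → step≤ (≤∧≢⇒< (s≤s⁻¹ u<v) (v≢ ∘ sym))))
    ; last≤  = λ { refl → subst (λ x → e + l ≤ x + k) (sym (assigned-here first v e)) (+-monoʳ-≤ e l≤k) }
    }
    where open Firsts inv

  record Ranges (first : Row) : Set where
    field
      range≤ : ∀ {v} → v < n → first (suc v) ≤ first v + k
      end≤   : ∀ {v} → v < n → first (suc v) ≤ k * n

  -- The closing store at index `n` acts like recording one more vertex without edges, so
  -- `next-firsts` applies with `l = 0`.
  ranges : ∀ {e first} → Firsts n e first → Ranges (first [ n ≔ e ])
  ranges {e} {first} inv = record
    { range≤ = λ v<n → step≤ (s≤s v<n)
    ; end≤   = λ v<n → ≤-trans (first≤ (s≤s v<n)) (*-monoʳ-≤ k v<n)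
    }
    where open Firsts (next-firsts {l = 0} z≤n inv)

  edge-index< : ∀ {v e i} → e ≤ k * v → v < n → i < k → e + i < k * n
  edge-index< {v} {e} {i} e≤ v<n i<k = begin-strict
    e + i      <⟨ +-mono-≤-< e≤ i<k ⟩
    k * v + k  ≡⟨ trans (+-comm (k * v) k) (sym (*-suc k v)) ⟩
    k * suc v  ≤⟨ *-monoʳ-≤ k v<n ⟩
    k * n      ∎
    where open ≤-Reasoning

-- Adjacency lists

module _ {A B : Set} (f : A → Maybe B) (P : A → Set)
  (injective : ∀ {x y z} → P x → P y → f x ≡ just z → f y ≡ just z → x ≡ y) where

  mapMaybe-avoids : ∀ {x z xs} → f x ≡ just z → P x → All P xs → All (x ≢_) xs → All (z ≢_) (mapMaybe f xs)
  mapMaybe-avoids eq px [] [] = []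
  mapMaybe-avoids {xs = y ∷ _} eq px (py ∷ pxs) (x≢y ∷ x≢) with f y in eq′
  ... | nothing = mapMaybe-avoids eq px pxs x≢
  ... | just z′ = (λ { refl → x≢y (injective px py eq eq′) }) ∷ mapMaybe-avoids eq px pxs x≢

  -- The function meant is `opposite v`, which is injective only among oriented edges; hence the
  -- predicate `P`.
  mapMaybe-unique : ∀ {xs} → All P xs → Unique xs → Unique (mapMaybe f xs)
  mapMaybe-unique [] [] = []
  mapMaybe-unique {x ∷ _} (px ∷ pxs) (x≢ ∷ distinct) with f x in eq
  ... | nothing = mapMaybe-unique pxs distinct
  ... | just _  = mapMaybe-avoids eq px pxs x≢ ∷ mapMaybe-unique pxs distinct

sum-map-≤ : ∀ {A : Set} {f g : A → ℕ} xs → (∀ x → f x ≤ g x) → sum (List.map f xs) ≤ sum (List.map g xs)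
sum-map-≤ []       f≤g = z≤n
sum-map-≤ (x ∷ xs) f≤g = +-mono-≤ (f≤g x) (sum-map-≤ xs f≤g)

sum-map-+ : ∀ {A : Set} (f g : A → ℕ) xs →
            sum (List.map (λ x → f x + g x) xs) ≡ sum (List.map f xs) + sum (List.map g xs)
sum-map-+ f g []       = refl
sum-map-+ f g (x ∷ xs) = begin
  f x + g x + sum (List.map (λ x → f x + g x) xs)  ≡⟨ cong (f x + g x +_) (sum-map-+ f g xs) ⟩
  f x + g x + (Σf + Σg)                            ≡⟨ solve 4 (λ a b c d → a :+ b :+ (c :+ d) := a :+ c :+ (b :+ d))
                                                        refl (f x) (g x) Σf Σg ⟩
  f x + Σf + (g x + Σg)                            ∎
  where
  open ≡-Reasoning
  open +-*-Solver
  Σf Σg : ℕ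
  Σf = sum (List.map f xs)
  Σg = sum (List.map g xs)

-- Neighbours and degrees in a simple graph

module _ (G : Graph) where
  open Graph G

  private
    Oriented : Fin n × Fin n → Set
    Oriented (a , b) = a Fin.< b

  -- The neighbour `u` of `v` can stem from (v , u) or from (u , v). If each of the two edges had
  -- one of these forms, orientation would give both `v < u` and `u < v`.
  opposite-injective : ∀ v {x y u} → Oriented x → Oriented y →
                       opposite v x ≡ just u → opposite v y ≡ just u → x ≡ y
  opposite-injective v {a , b} {a′ , b′} a<b a′<b′ eq eq′
    with v Fin.≟ a | v Fin.≟ b | v Fin.≟ a′ | v Fin.≟ b′
  ... | yes refl | _        | yes refl | _        = cong (v ,_) (just-injective (trans eq (sym eq′)))
  ... | yes refl | _        | no _     | yes refl with refl ← trans eq (sym eq′) = contradiction a′<b′ (<-asym a<b)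
  ... | no _     | yes refl | yes refl | _        with refl ← trans eq (sym eq′) = contradiction a′<b′ (<-asym a<b)
  ... | no _     | yes refl | no _     | yes refl = cong (_, v) (just-injective (trans eq (sym eq′)))
  ... | no _     | no _     | _        | _        with () ← eq
  ... | yes _    | _        | no _     | no _     with () ← eq′
  ... | no _     | yes _    | no _     | no _     with () ← eq′

  neighbours-unique : ∀ v → Unique (neighbours v)
  neighbours-unique v = mapMaybe-unique (opposite v) Oriented (opposite-injective v) oriented distinct

  private
    matches : Fin n → Fin n → ℕ
    matches a u with u Fin.≟ a
    ... | yes _ = 1
    ... | no  _ = 0

    degree-∷ : ∀ a b es u → length (mapMaybe (opposite u) ((a , b) ∷ es)) ≤
                            matches a u + matches b u + length (mapMaybe (opposite u) es)
    degree-∷ a b es u with u Fin.≟ a | u Fin.≟ b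
    ... | yes _ | _     = s≤s (m≤n+m _ _)
    ... | no _  | yes _ = ≤-refl
    ... | no _  | no _  = ≤-refl

    sum-matches-none : ∀ {a us} → All (a ≢_) us → sum (List.map (matches a) us) ≡ 0
    sum-matches-none []         = refl
    sum-matches-none {a} {u ∷ _} (a≢u ∷ a≢) with u Fin.≟ a
    ... | yes refl = contradiction refl a≢u
    ... | no  _    = sum-matches-none a≢

    sum-matches : ∀ a {us} → Unique us → sum (List.map (matches a) us) ≤ 1
    sum-matches a []               = z≤n
    sum-matches a {u ∷ _} (u≢ ∷ distinct) with u Fin.≟ a
    ... | yes refl = ≤-reflexive (cong suc (sum-matches-none u≢))
    ... | no  _    = sum-matches a distinct

  -- The upper half of the handshake lemma, by induction on the edges: an edge adds at most one to
  -- the degree of either endpoint, and each endpoint occurs at most once in `us`.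
  sum-degrees : ∀ es {us} → Unique us → sum (List.map (λ u → length (mapMaybe (opposite u) es)) us) ≤ 2 * length es
  sum-degrees []             {us} distinct = ≤-reflexive (zeros us)
    where
    zeros : ∀ (us : List (Fin n)) → sum (List.map (λ _ → 0) us) ≡ 0
    zeros []       = refl
    zeros (_ ∷ us) = zeros us
  sum-degrees ((a , b) ∷ es) {us} distinct = begin
    sum (List.map (λ u → length (mapMaybe (opposite u) ((a , b) ∷ es))) us)
      ≤⟨ sum-map-≤ us (degree-∷ a b es) ⟩
    sum (List.map (λ u → matches a u + matches b u + degree u) us)
      ≡⟨ sum-map-+ (λ u → matches a u + matches b u) degree us ⟩
    sum (List.map (λ u → matches a u + matches b u) us) + sum (List.map degree us)
      ≡⟨ cong (_+ sum (List.map degree us)) (sum-map-+ (matches a) (matches b) us) ⟩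
    sum (List.map (matches a) us) + sum (List.map (matches b) us) + sum (List.map degree us)
      ≤⟨ +-mono-≤ (+-mono-≤ (sum-matches a distinct) (sum-matches b distinct)) (sum-degrees es distinct) ⟩
    2 + 2 * length es
      ≡⟨ *-suc 2 (length es) ⟨
    2 * length ((a , b) ∷ es) ∎
    where
    open ≤-Reasoning
    degree : Fin n → ℕ
    degree u = length (mapMaybe (opposite u) es)

-- Since `take` saturates, this is constant from the length of `xss` onwards. So it is monotone at
-- every natural number, as required of `off`, and numbers that are no vertices have empty segments.
starts : ∀ {A : Set} → List (List A) → ℕ → ℕ
starts xss u = sum (take u (List.map length xss))

starts-suc : ∀ {A : Set} (xss : List (List A)) u → starts xss u ≤ starts xss (suc u)
starts-suc []         zero    = z≤n
starts-suc []         (suc u) = z≤n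
starts-suc (xs ∷ xss) zero    = z≤n
starts-suc (xs ∷ xss) (suc u) = +-monoʳ-≤ (length xs) (starts-suc xss u)

starts≤length : ∀ {A : Set} (xss : List (List A)) u → starts xss u ≤ length (concat xss)
starts≤length []         zero    = z≤n
starts≤length []         (suc u) = z≤n
starts≤length (xs ∷ xss) zero    = z≤n
starts≤length (xs ∷ xss) (suc u) = ≤-trans (+-monoʳ-≤ (length xs) (starts≤length xss u))
                                           (≤-reflexive (sym (length-++ xs)))

length-concat : ∀ {A : Set} (xss : List (List A)) → length (concat xss) ≡ sum (List.map length xss)
length-concat []         = refl
length-concat (xs ∷ xss) = trans (length-++ xs) (cong (length xs +_) (length-concat xss))

module Layout (ℛ : Reals) (constants : Constants ℛ) (d t steps kmax : ℕ)
  (x : SL-GUMAP.Instance ℛ constants d t steps kmax) where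
  open SL-GUMAP.Instance x using (at)

  all-at : ∀ {P : ℕ → Set} {xs i} → All P xs → i < length xs → P (at xs i)
  all-at {i = zero}  (px ∷ _)  _        = px
  all-at {i = suc _} (_ ∷ pxs) (s≤s i<) = all-at pxs i<

  at-++ˡ : ∀ xs {ys i} → i < length xs → at (xs ++ ys) i ≡ at xs i
  at-++ˡ (x ∷ xs) {i = zero}  _        = refl
  at-++ˡ (x ∷ xs) {i = suc _} (s≤s i<) = at-++ˡ xs i<

  at-++ʳ : ∀ xs {ys} i → at (xs ++ ys) (length xs + i) ≡ at ys i
  at-++ʳ []       i = refl
  at-++ʳ (_ ∷ xs) i = at-++ʳ xs i

  at-injective : ∀ {xs i j} → Unique xs → i < length xs → j < length xs → at xs i ≡ at xs j → i ≡ j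
  at-injective {i = zero}  {zero}  _ _ _ _ = refl
  at-injective {i = zero}  {suc _} (x≢ ∷ _) _ (s≤s j<) eq = contradiction eq (all-at x≢ j<)
  at-injective {i = suc _} {zero}  (x≢ ∷ _) (s≤s i<) _ eq = contradiction (sym eq) (all-at x≢ i<)
  at-injective {i = suc _} {suc _} (_ ∷ distinct) (s≤s i<) (s≤s j<) eq = cong suc (at-injective distinct i< j< eq)

  at-concat-injective : ∀ xss → All Unique xss → ∀ u {i j} →
    starts xss u ≤ i → i < starts xss (suc u) → starts xss u ≤ j → j < starts xss (suc u) →
    at (concat xss) i ≡ at (concat xss) j → i ≡ j
  at-concat-injective (xs ∷ xss) (distinct ∷ _) zero {i} {j} _ i< _ j< eq =
    at-injective distinct i<′ j<′ (trans (sym (at-++ˡ xs i<′)) (trans eq (at-++ˡ xs j<′)))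
    where
    i<′ : i < length xs
    i<′ = subst (i <_) (+-identityʳ _) i<
    j<′ : j < length xs
    j<′ = subst (j <_) (+-identityʳ _) j<
  at-concat-injective (xs ∷ xss) (_ ∷ distinct) (suc u) {i} {j} ≤i i< ≤j j< eq
    with i′ , refl ← m≤n⇒∃[o]m+o≡n (≤-trans (m≤m+n (length xs) _) ≤i)
       | j′ , refl ← m≤n⇒∃[o]m+o≡n (≤-trans (m≤m+n (length xs) _) ≤j) =
    cong (length xs +_) (at-concat-injective xss distinct u
      (+-cancelˡ-≤ (length xs) _ _ ≤i) (+-cancelˡ-< (length xs) _ _ i<)
      (+-cancelˡ-≤ (length xs) _ _ ≤j) (+-cancelˡ-< (length xs) _ _ j<)
      (trans (sym (at-++ʳ xs i′)) (trans eq (at-++ʳ xs j′))))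

-- The programs

-- The running times below are added up by the rules of WeakestPreconditions,
-- and are not simplified so that they agree with those sums by definition.
-- K bounds the neighbourhood size k.
isKnownTime : ℕ → ℕ
isKnownTime K = 6 + (suc K * 11 + 2)

expandTime : ℕ → ℕ
expandTime K = 8 + suc K * (16 + (isKnownTime K + 16))

searchTime : ℕ → ℕ
searchTime K = 10 + suc K * (8 + (suc (expandTime K + 0) + 1))

record-edgesTime : ℕ → ℕ
record-edgesTime K = 8 + (K * 15 + 5)

partialBFSTime : ℕ → ℕ → ℕ
partialBFSTime K n = 6 + (n * suc (searchTime K + record-edgesTime K + 2) + 3)

bandwidthTime : ℕ → ℕ → ℕ
bandwidthTime K steps = 21 + (steps * suc (8 + (K * 18 + 29) + 2) + 2)

weightingTime : ℕ → ℕ → ℕ → ℕ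
weightingTime K steps n = 3 + n * suc (6 + (3 + (bandwidthTime K steps + (2 + K * 15)) + 0) + 2)

prepareTime : ℕ → ℕ
prepareTime E = 3 + (E * 29 + (4 + (E * 52 + 3)))

descendAlongTime : ℕ → ℕ
descendAlongTime d = 9 + (6 + (d * 19 + 2) + (41 + d * 26))

gradSampleTime : ℕ → ℕ
gradSampleTime d = 17 + suc (descendAlongTime d + 2)

module Programs
  (ℛ : Reals) (constants : Constants ℛ) (ω : Randomness) (d steps K n k L : ℕ) (k≤K : k ≤ K)
  (off : ℕ → ℕ) (off≤ : ∀ u → off u ≤ off (suc u)) (off≤L : ∀ u → off u ≤ L) where

  open Semantics ℛ constants ω
  open Invariants n k L off off≤ off≤L

  -- Entry i bounds the indices accessed in array i.
  limit : Word → Fin 16 → ℕ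
  limit nat = Vec.lookup
    (1 ∷ suc n ∷ L ∷ suc k ∷ suc k ∷ 1 ∷ 1 ∷ 1 ∷
     k * n ∷ k * n ∷ k * n ∷ suc n ∷ 1 ∷ 1 ∷ 1 ∷ 0 ∷ [])
  limit real = Vec.lookup
    (k * n ∷ 1 ∷ 1 ∷ 1 ∷ 1 ∷ n * d ∷ 0 ∷ 0 ∷ 0 ∷ 0 ∷ 0 ∷ 0 ∷ 0 ∷ 0 ∷ 0 ∷ 0 ∷ [])

  open WeakestPreconditions ℛ constants ω limit

  row : Array nat → Cells → Row
  row a c = c nat (Array.name a)

  -- `P` is whatever the caller wants carried through the call. The search relies on positive
  -- answers: after a negative one the vertex is appended, so it is in the queue either way.
  isKnown-correct : (P : Cells → Set) → (∀ {c i x} → P c → P (update nat (Array.name known) i x c)) →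
                    (∀ {c} → P c → row visited c 0 ≤ suc k) →
                    ∀ {c w} → P c →
                    WP c (isKnown (var w)) (isKnownTime K)
                       (λ b c′ → P c′ × (b ≢ 0 → Queued (row queue c′) (row visited c′) w))
  isKnown-correct P ignore visited≤ {c} {w} pc = do
      storing (s≤s z≤n)
      loading (s≤s z≤n) refl
      found ← looping (λ _ → Found) Found (suc K) (λ i< _ → <-≤-trans i< (≤-trans (visited≤ pc) (s≤s k≤K)))
        (refl , ignore pc , λ nz → contradiction refl nz) id
        λ {i} {c} i< (eq , p , found) → do
          loading (<-≤-trans i< (visited≤ pc)) refl
          inv ← branching {Q = λ _ → Found}
            (λ nz → storing (s≤s z≤n) (eq , ignore p , λ _ → queued (subst (i <_) (sym eq) i<)
              (≡ᵇ⇒≡ _ _ (subst T (sym (boolean≢0 _ nz)) tt))))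
            (λ _ → skipping (eq , p , found))
          returning ((λ _ → inv) , (λ _ → inv))
      loading (s≤s z≤n) refl (proj₂ found)
    where
    Found : Cells → Set
    -- The equation links the loop bound, read before the loop, to the current count.
    Found c′ = row visited c′ 0 ≡ row visited c 0 × P c′ ×
               (row known c′ 0 ≢ 0 → Queued (row queue c′) (row visited c′) w)

  boolean-both : ∀ a b → boolean a * boolean b ≢ 0 → a ≡ true × b ≡ true
  boolean-both true  true  _  = refl , refl
  boolean-both true  false nz = contradiction refl nz
  boolean-both false b     nz = contradiction refl nz

  <-true : ∀ {i j} → (i <ᵇ j) ≡ true → i < j
  <-true {i} {j} eq = <ᵇ⇒< i j (subst T (sym eq) tt)

  swapping : ∀ {w c} {a : Array w} {e f : Expr ⟦_⟧ nat} {Q : Post void} (let b = Array.name a) →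
             eval e < limit w b → eval f < limit w b →
             Q tt (update w b (eval f) (c w b (eval e)) (update w b (eval e) (c w b (eval f)) c)) →
             WP c (swap a e f)
               (suc (size e) + (suc (size f) + (suc (size e + 0) + suc (size f + 0)))) Q
  swapping e< f< q = do
    loading e< refl
    loading f< refl
    storing e<
    storing f< q

  -- Searches and the recording of edges

  Recorded : ℕ → Cells → Set
  Recorded v c = Endpoints (row edgeCount c 0) (row source c) (row target c) ×
                 Firsts v (row edgeCount c 0) (row first c)

  below-∸ : ∀ a b {i} → i < b ∸ a → a + i < b
  below-∸ a b {i} i< = subst (a + i <_) (m+[n∸m]≡n (<⇒≤ a<b)) (+-monoʳ-< a i<)
    where
    a<b : a < b
    a<b = m∸n≢0⇒n<m {b} {a} (>⇒≢ (≤-<-trans z≤n i<))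

  record Searched (b v : ℕ) (c : Cells) : Set where
    constructor searched
    field
      adj : Adjacency (row order c) (row offset c) (row adjacency c)
      que : Queue b (row queue c) (row visited c)
      rec : Recorded v c

  record Scanning (b v u i : ℕ) (c : Cells) : Set where
    constructor scanning
    field
      state : Searched b v c
      scans : Scanned u i (row adjacency c) (row queue c) (row visited c)

  enlarge : ∀ {v c} → Searched k v c → Searched (suc k) v c
  enlarge (searched adj q rec) = searched adj (record { Queue q ; visited≤ = m≤n⇒m≤1+n (Queue.visited≤ q) }) rec

  restrict : ∀ {v c} → row visited c 0 < suc k → Searched (suc k) v c → Searched k v c
  restrict c≤k (searched adj q rec) = searched adj (record { Queue q ; visited≤ = s≤s⁻¹ c≤k }) rec

  -- Here the degree of `u` drops out: while the scan goes on the queue holds at most `k` vertices,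
  -- and the neighbours scanned inject into it.
  scanning-bound : ∀ {v u i c} → i < off (suc u) ∸ off u → Scanning k v u i c → i < suc K
  scanning-bound i< (scanning (searched adj q _) scan) =
    s≤s (≤-trans (scanned≤visited adj scan (<⇒≤ i<)) (≤-trans (Queue.visited≤ q) k≤K))

  search-correct : ∀ {v c} → v < n →
                   Adjacency (row order c) (row offset c) (row adjacency c) → Recorded v c →
                   WP c (search k (var v)) (searchTime K) (λ _ → Searched (suc k) v)
  -- The `do` block determines its own time by inference; `relax` with `≤-refl` then compares it
  -- with the stated time by computation.
  search-correct {v} {c} v<n adj rec = relax (do
    storing (s≤s z≤n)
    storing (s≤s z≤n)
    storing (s≤s z≤n)
    looping (λ _ → Searched (suc k) v) (Searched (suc k) v) (suc K) (λ i< _ → <-≤-trans i< (s≤s k≤K))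
      (searched adj (record { visited≤ = s≤s z≤n ; queue< = λ { {zero} _ → v<n ; {suc _} (s≤s ()) } }) rec) id
      λ {h} {c} h≤k s@(searched adj q rec) → do
        loading (s≤s z≤n) refl
        returning
        s ← branching {t₁ = expandTime K} {Q = λ _ → Searched (suc k) v}
          (λ nz →
            let u = row queue c h
                h<c , c≤k = map <-true <-true (boolean-both (h <ᵇ row visited c 0) (row visited c 0 <ᵇ suc k) nz)
                u<n = Queue.queue< q h<c
            in relax (do
            loading h≤k refl
            loading h≤k refl
            loading (m≤n⇒m≤1+n u<n) (Adjacency.offset≡ adj u)
            loading (subst (_< suc n) (+-comm 1 u) (s≤s u<n))
                    (trans (Adjacency.offset≡ adj (u + 1)) (cong off (+-comm u 1)))
            looping (Scanning k v u) (Searched (suc k) v) (suc K) scanning-bound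
              (scanning (restrict c≤k s) (scanned λ ())) (enlarge ∘ Scanning.state)
              λ {i} {c} i< (scanning (searched adj q rec) scans) →
              drawing (m<n⇒0<n∸m i<) >>= λ {r} → λ { (r< , refl) →
              let p      = off u + i
                  p∈u    = in-segment {u} i<
                  p+r∈u  = shifted {u} {i} {r} i< r<
                  w      = transposed (row adjacency c) p (p + r) p
              in do
                swapping (segment<L {u} p∈u) (segment<L {u} p+r∈u)
                loading (segment<L {u} p∈u) refl
                -- The equation in the carried invariant identifies the tested vertex `w` with the
                -- entry at position `p` after the call.
                (searched adj q rec , scans , here) , found ← isKnown-correct
                  (λ c → Searched k v c × Scanned u i (row adjacency c) (row queue c) (row visited c) ×
                         row adjacency c p ≡ w)
                  (λ (searched adj q rec , rest) → searched adj q rec , rest)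
                  (λ (searched _ q _ , _) → m≤n⇒m≤1+n (Queue.visited≤ q))
                  (searched (swap-adjacency p∈u p+r∈u adj) q rec , swap-scanned scans , refl)
                scanning s scans ← branching {Q = λ _ → Scanning (suc k) v u (suc i)}
                  (λ nz → skipping (scanning (enlarge (searched adj q rec))
                                             (scan scans (subst (Queued _ _) (sym here) (found nz)))))
                  (λ _ → do
                    loading (s≤s z≤n) refl
                    storing (s≤s (Queue.visited≤ q))
                    storing (s≤s (Queue.visited≤ q))
                    storing (s≤s z≤n) (scanning
                      (searched adj (enqueue (subst (_< n) here (Adjacency.below adj (segment<L {u} p∈u))) q) rec)
                      (scan (still-scanned scans) (subst (Queued _ _) (sym here) now-queued))))
                loading (s≤s z≤n) refl
                -- A nonzero result says that there is room again, which restores the bound `k` for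
                -- the next iteration; zero ends the scan with a full queue.
                returning ((λ nz → scanning (restrict (<-true (boolean≢0 _ nz)) s) scans) , (λ _ → s)) }) ≤-refl)
          (λ _ → skipping s)
        returning ((λ _ → s) , (λ _ → s))) ≤-refl

  -- `edgeCount` is stored only after the loop, so `firsts` already speaks of the final count, while
  -- `ends` grows with `i` from the old count `e`.
  record Recording (v e l i : ℕ) (c : Cells) : Set where
    constructor recording
    field
      adj      : Adjacency (row order c) (row offset c) (row adjacency c)
      que      : Queue (suc k) (row queue c) (row visited c)
      visited≡ : row visited c 0 ≡ l
      ends     : Endpoints (e + i) (row source c) (row target c)
      firsts   : Firsts (suc v) (e + (l ∸ 1)) (row first c)

  Listed : ℕ → Cells → Set
  Listed v c = Adjacency (row order c) (row offset c) (row adjacency c) × Recorded v c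

  record-edges-correct : ∀ {v c} → v < n → Searched (suc k) v c →
                         WP c (record-edges (var v)) (record-edgesTime K) (λ _ → Listed (suc v))
  record-edges-correct {v} {c} v<n (searched adj q (ends , firsts)) = relax (do
    loading (s≤s z≤n) refl
    loading (s≤s z≤n) refl
    storing (m≤n⇒m≤1+n v<n)
    recording adj _ _ ends firsts ← counting (Recording v e l) K (≤-trans l∸1≤k k≤K)
      record
        { adj = adj ; que = q ; visited≡ = refl
        ; ends = recount (sym (+-identityʳ e)) ends
        ; firsts = next-firsts l∸1≤k firsts
        }
      λ {i} {c} i< (recording adj que visited≡ ends firsts) →
        let index = edge-index< (Firsts.count≤ firsts₀) v<n (<-≤-trans i< l∸1≤k)
            i+1<l = below-pred l i<
            i+1≤k = ≤-trans i+1<l (Queue.visited≤ q)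
        in do
          loading i+1≤k refl
          loading i+1≤k refl
          storing index
          storing index
          storing index record
            { adj = adj ; que = que ; visited≡ = visited≡ ; firsts = firsts
            ; ends = recount (sym (+-suc e i))
                (new-endpoints v<n (Queue.queue< que (subst (i + 1 <_) (sym visited≡) i+1<l)) ends)
            }
    storing (s≤s z≤n) (adj , ends , firsts)) ≤-refl
    where
    e l : ℕ
    e = row edgeCount c 0
    l = row visited c 0

    firsts₀ : Firsts v e (row first c)
    firsts₀ = firsts

    l∸1≤k : l ∸ 1 ≤ k
    l∸1≤k = ∸-monoˡ-≤ 1 (Queue.visited≤ q)

    below-pred : ∀ {i} l → i < l ∸ 1 → i + 1 < l
    below-pred {i} (suc l) i<l = s≤s (subst (_≤ l) (+-comm 1 i) i<l)


  record IndexedRows (E : ℕ) (order edgeCount source target first : Row) : Set where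
    constructor indexed
    field
      order≡     : order 0 ≡ n
      edgeCount≡ : edgeCount 0 ≡ E
      E≤         : E ≤ k * n
      ends       : Endpoints E source target
      index      : Ranges first

  Indexed : ℕ → Cells → Set
  Indexed E c = IndexedRows E (row order c) (row edgeCount c) (row source c) (row target c) (row first c)

  partialBFS-correct : ∀ {c} → Adjacency (row order c) (row offset c) (row adjacency c) →
                       WP c (partialBFS k) (partialBFSTime K n) (λ _ c → Indexed (row edgeCount c 0) c)
  partialBFS-correct {c} adj = relax (do
    loading (s≤s z≤n) (Adjacency.order≡ adj)
    storing (s≤s z≤n)
    adj , ends , firsts ← counting Listed n ≤-refl
      (adj , endpoints (λ ()) (λ ()) , record { count≤ = z≤n ; first≤ = λ () ; step≤ = λ () ; last≤ = λ () })
      λ v<n (adj , rec) → do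
        s ← search-correct v<n adj rec
        record-edges-correct v<n s
    loading (s≤s z≤n) refl
    storing ≤-refl record
      { order≡ = Adjacency.order≡ adj ; edgeCount≡ = refl ; E≤ = Firsts.count≤ firsts
      ; ends = ends ; index = ranges firsts }) ≤-refl

  -- Edge weights

  membership-correct : ∀ {c ρ σ e i} (P : Cells → Set) → e + i < k * n → P c →
                       WP c (membership (var ρ) (var σ) (var e Defs.Expr.+ var i)) 10 (λ _ → P)
  membership-correct P e+i< pc = do
    loading e+i< refl
    returning pc

  -- Bisection writes only to arrays that `Indexed` does not mention, so the invariant passes
  -- through every store by conversion.
  bandwidth-correct : ∀ {E c e e′ ρ} → e′ ∸ e ≤ k → e′ ≤ k * n → Indexed E c →
                      WP c (bandwidth k steps (var e) (var e′ Defs.Expr.- var e) (var ρ))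
                         (bandwidthTime K steps) (λ _ → Indexed E)
  bandwidth-correct {E} {e = e} {e′} l≤k e′≤ inv = relax (do
    returning
    storing (s≤s z≤n)
    storing (s≤s z≤n)
    storing (s≤s z≤n)
    inv ← counting (λ _ → Indexed E) steps ≤-refl inv λ _ inv → do
      loading (s≤s z≤n) refl
      storing (s≤s z≤n)
      inv ← counting (λ _ → Indexed E) K (≤-trans l≤k k≤K) inv λ {i} i< inv → do
        inv ← membership-correct (Indexed E) (<-≤-trans (below-∸ e e′ i<) e′≤) inv
        loading (s≤s z≤n) refl
        storing (s≤s z≤n) inv
      loading (s≤s z≤n) refl
      inv ← branching {Q = λ _ → Indexed E}
        (λ _ → do
          storing (s≤s z≤n)
          storing (s≤s z≤n) inv)
        (λ _ → storing (s≤s z≤n) inv)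
      loading (s≤s z≤n) refl
      branching
        (λ _ → do
          loading (s≤s z≤n) refl
          loading (s≤s z≤n) refl
          storing (s≤s z≤n) inv)
        (λ _ → storing (s≤s z≤n) inv)
    loading (s≤s z≤n) refl inv) ≤-refl

  weighting-correct : ∀ {E c} → Indexed E c → WP c (weighting k steps) (weightingTime K steps n) (λ _ → Indexed E)
  weighting-correct {E} inv = relax (do
    loading (s≤s z≤n) (IndexedRows.order≡ inv)
    counting (λ _ → Indexed E) n ≤-refl inv λ {v} {c} v<n inv →
      let f       = row first c
          e′≤e+k  = Ranges.range≤ (IndexedRows.index inv) v<n
          e′≤     = Ranges.end≤ (IndexedRows.index inv) v<n
          l≤k     = m≤n+o⇒m∸n≤o (f (suc v)) (f v) e′≤e+k
      in do
        loading (m≤n⇒m≤1+n v<n) refl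
        loading (subst (_< suc n) (+-comm 1 v) (s≤s v<n)) (cong f (+-comm v 1))
        branching
          (λ nz → do
            loading (<-≤-trans (<-true (boolean≢0 _ nz)) e′≤) refl
            returning
            inv ← bandwidth-correct l≤k e′≤ inv
            counting (λ _ → Indexed E) K (≤-trans l≤k k≤K) inv λ i< inv → do
              inv ← membership-correct (Indexed E) (<-≤-trans (below-∸ (f v) (f (suc v)) i<) e′≤) inv
              storing (<-≤-trans (below-∸ (f v) (f (suc v)) i<) e′≤) inv)
          (λ _ → skipping inv)) ≤-refl

  -- Shuffling and the sample size

  eval-power : ∀ p e → eval (power p e) ≡ eval e ^ p
  eval-power zero    e = refl
  eval-power (suc p) e = cong (eval e *_) (eval-power p e)

  -- `sample≤` serves the linear bound on the total time, `power≤` the sublinear bound on one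
  -- iteration of C2.
  record PreparedRows (E : ℕ) (edgeCount source target sampleSize : Row) : Set where
    constructor prepared
    field
      edgeCount≡ : edgeCount 0 ≡ E
      ends       : Endpoints E source target
      sample≤    : sampleSize 0 ≤ E
      power≤     : sampleSize 0 ^ 10 ≤ E ^ 9

  Prepared : ℕ → Cells → Set
  Prepared E c = PreparedRows E (row edgeCount c) (row source c) (row target c) (row sampleSize c)

  Shuffled : ℕ → Cells → Set
  Shuffled E c = row edgeCount c 0 ≡ E × Endpoints E (row source c) (row target c)

  prepare-correct : ∀ {E c} → E ≤ k * n → Shuffled E c → WP c prepare (prepareTime (K * n)) (λ _ → Prepared E)
  prepare-correct {E} E≤ (refl , ends) = relax (do
    loading (s≤s z≤n) refl
    eq , ends ← counting (λ _ → Shuffled E) (K * n) E≤K*n (refl , ends)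
      λ {i} i<E (eq , ends) → drawing (m<n⇒0<n∸m i<E) >>= λ {r} → λ { (r< , refl) →
        let j<E = subst (i + r <_) (m+[n∸m]≡n (<⇒≤ i<E)) (+-monoʳ-< i r<)
            i<  = <-≤-trans i<E E≤
            j<  = <-≤-trans j<E E≤
        in do
          swapping i< j<
          swapping i< j<
          swapping i< j<
          swapping i< j< (eq , swap-target i<E j<E (swap-source i<E j<E ends)) }
    storing (s≤s z≤n)
    prepared eq ends s≤ s^≤ ← looping (λ _ → Prepared E) (Prepared E) (K * n) (λ i< _ → <-≤-trans i< E≤K*n)
      (prepared eq ends z≤n z≤n) id
      λ {i} i<E inv@(prepared eq ends s≤ s^≤) → do
        returning
        inv ← branching {Q = λ _ → Prepared E}
          (λ nz → storing (s≤s z≤n) (prepared eq ends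
            (subst (_≤ E) (+-comm 1 i) i<E)
            (fits i (boolean≢0 _ nz))))
          (λ _ → skipping inv)
        returning ((λ _ → inv) , (λ _ → inv))
    storing (s≤s z≤n) (prepared eq ends s≤ s^≤)) ≤-refl
    where
    E≤K*n : E ≤ K * n
    E≤K*n = ≤-trans E≤ (*-monoˡ-≤ n k≤K)

    fits : ∀ i → (eval (power 10 (var i Defs.Expr.+ lit 1)) <ᵇ eval (power 9 (var E)) + 1) ≡ true →
           (i + 1) ^ 10 ≤ E ^ 9
    fits i eq = s≤s⁻¹ (subst₂ _<_ (eval-power 10 (var i Defs.Expr.+ lit 1))
      (trans (+-comm _ 1) (cong suc (eval-power 9 (var E)))) (<-true eq))

  -- Gradient descent

  record ReadyRows (E s : ℕ) (edgeCount source target sampleSize : Row) : Set where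
    constructor ready
    field
      edgeCount≡  : edgeCount 0 ≡ E
      sampleSize≡ : sampleSize 0 ≡ s
      ends        : Endpoints E source target

  Ready : ℕ → ℕ → Cells → Set
  Ready E s c = ReadyRows E s (row edgeCount c) (row source c) (row target c) (row sampleSize c)

  mod< : ∀ x {y} → y ≢ 0 → mod x y < y
  mod< x {zero}  y≢0 = contradiction refl y≢0
  mod< x {suc y} _   = m%n<n x (suc y)

  layout-index< : ∀ {a i} → a < n → i < d → a * d + i < n * d
  layout-index< {a} {i} a<n i<d = begin-strict
    a * d + i  <⟨ +-monoʳ-< (a * d) i<d ⟩
    a * d + d  ≡⟨ +-comm (a * d) d ⟩
    suc a * d  ≤⟨ *-monoˡ-≤ d a<n ⟩
    n * d      ∎
    where open ≤-Reasoning

  -- The index `e` is an expression evaluated anew by three loads, so its size enters the time; for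
  -- the index `(j + i) % E` of the sample it is 2.
  descendAlong-correct : ∀ {E s c rate e} → E ≤ k * n → eval e < E → size e ≡ 2 → Ready E s c →
                         WP c (descendAlong d (var rate) e) (descendAlongTime d) (λ _ → Ready E s)
  descendAlong-correct {E} {s} {c} {e = e} E≤ e<E size≡ inv@(ready eqE eqs ends) = relax (do
    loading (<-≤-trans e<E E≤) refl
    loading (<-≤-trans e<E E≤) refl
    loading (<-≤-trans e<E E≤) refl
    inv ← do
      storing (s≤s z≤n)
      inv ← counting (λ _ → Ready E s) d ≤-refl inv λ i<d inv → do
        loading (layout-index< a<n i<d) refl
        loading (layout-index< b<n i<d) refl
        loading (s≤s z≤n) refl
        storing (s≤s z≤n) inv
      loading {Q = λ _ → Ready E s} (s≤s z≤n) refl inv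
    returning
    returning
    counting (λ _ → Ready E s) d ≤-refl inv λ i<d inv → do
      loading (layout-index< a<n i<d) refl
      loading (layout-index< b<n i<d) refl
      returning
      storing (layout-index< a<n i<d)
      storing (layout-index< b<n i<d) inv) 
      (≤-reflexive (cong (λ l → suc l + (suc l + (suc l + (6 + (d * 19 + 2) + (41 + d * 26))))) size≡))
    where
    a<n : row source c (eval e) < n
    a<n = Endpoints.source< ends e<E
    b<n : row target c (eval e) < n
    b<n = Endpoints.target< ends e<E

  -- The bound on `size round` covers both uses: a loop variable, of size 0, and the literal of a
  -- single round, of size 1.
  gradSample-correct : ∀ {E s c round} → E ≤ k * n → size round ≤ 1 → Ready E s c →
                       WP c (gradSample d round) (gradSampleTime d * suc s) (λ _ → Ready E s)
  gradSample-correct {E} {s} {round = round} E≤ size≤ inv@(ready eqE eqs ends) = relax (do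
    loading (s≤s z≤n) eqE
    loading (s≤s z≤n) eqs
    loading (s≤s z≤n) refl
    returning
    branching
      (λ E≢0 → do
        inv ← counting (λ _ → Ready E s) (suc s) (≤-reflexive (+-comm s 1)) inv λ {i} _ inv →
          descendAlong-correct E≤ (mod< _ E≢0) refl inv
        storing (s≤s z≤n) inv)
      (λ _ → skipping inv)) (begin
        8 + (size round + suc (2 + suc (suc s * D) + 4 + 0)) ≤⟨ +-monoʳ-≤ 8 (+-monoˡ-≤ _ size≤) ⟩
        13 + (suc s * D + 4 + 0)                             ≡⟨ solve 2 (λ s D →
          con 13 :+ (s :* D :+ con 4 :+ con 0) := con 17 :+ D :* s) refl (suc s) D ⟩
        -- The overhead of a round is absorbed by the factor `suc s`, as `power-bound` expects a
        -- pure multiple of `suc s`.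
        17 + D * suc s                                       ≤⟨ +-monoˡ-≤ (D * suc s) (m≤m*n 17 (suc s)) ⟩
        17 * suc s + D * suc s                               ≡⟨ *-distribʳ-+ (suc s) 17 D ⟨
        gradSampleTime d * suc s                             ∎)
    where
    open ≤-Reasoning
    open +-*-Solver
    D : ℕ
    D = suc (descendAlongTime d + 2)

  gradSamples-correct : ∀ {E s c} i → E ≤ k * n → Ready E s c →
                        WP c (gradSamples d i) (2 + i * suc (gradSampleTime d * suc s + 2)) (λ _ → Ready E s)
  gradSamples-correct {E} {s} i E≤ inv =
    counting (λ _ → Ready E s) i ≤-refl inv λ _ inv → gradSample-correct E≤ z≤n inv

-- Asymptotics

module Linearity {n : ℕ} (1≤n : 1 ≤ n) where

  -- A record rather than an abbreviation, lest unification unfold the products.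
  record Linear (f a : ℕ) : Set where
    constructor linear
    field
      holds : f ≤ a * n

  open Linear public

  -- As `1 ≤ n`, a constant is its own rate, while `n` has rate 1, and sums and multiples act on
  -- rates as on the functions. So the rate of such an expression is its value at 1 in place of `n`.
  constant : ∀ a → Linear a a
  constant a = linear (m≤m*n a n {{>-nonZero 1≤n}})

  variable-linear : Linear n 1
  variable-linear = linear (≤-reflexive (sym (*-identityˡ n)))

  at-most : ∀ {f g a} → f ≤ g → Linear g a → Linear f a
  at-most f≤g (linear g≤) = linear (≤-trans f≤g g≤)

  infixl 6 _+ᴸ_
  infixl 7 _*ᴸ_ _ᴸ*_

  _+ᴸ_ : ∀ {f g a b} → Linear f a → Linear g b → Linear (f + g) (a + b)
  _+ᴸ_ {a = a} {b} (linear f≤) (linear g≤) =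
    linear (≤-trans (+-mono-≤ f≤ g≤) (≤-reflexive (sym (*-distribʳ-+ n a b))))

  _*ᴸ_ : ∀ {f a} c → Linear f a → Linear (c * f) (c * a)
  _*ᴸ_ {a = a} c (linear f≤) = linear (≤-trans (*-monoʳ-≤ c f≤) (≤-reflexive (sym (*-assoc c a n))))

  _ᴸ*_ : ∀ {f a} → Linear f a → ∀ c → Linear (f * c) (a * c)
  _ᴸ*_ {f} {a} f≤ c = subst₂ Linear (*-comm c f) (*-comm c a) (c *ᴸ f≤)

^-distribʳ-* : ∀ m n o → (m * n) ^ o ≡ m ^ o * n ^ o
^-distribʳ-* m n zero    = refl
^-distribʳ-* m n (suc o) = begin
  m * n * (m * n) ^ o        ≡⟨ cong (m * n *_) (^-distribʳ-* m n o) ⟩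
  m * n * (m ^ o * n ^ o)    ≡⟨ [m*n]*[o*p]≡[m*o]*[n*p] m n (m ^ o) (n ^ o) ⟩
  m * m ^ o * (n * n ^ o)    ∎
  where open ≡-Reasoning

-- suc s ≤ 2 (s ⊔ 1), which is where the factor 2 comes from.
power-bound : ∀ p {f c s e b n} → f ≤ c * suc s → s ^ suc p ≤ e ^ p → e ≤ b * n → 1 ≤ b → 1 ≤ n →
              f ^ suc p ≤ (c * 2 * b) ^ suc p * n ^ p
power-bound p {f} {c} {s} {e} {b@(suc _)} {n@(suc _)} f≤ s^≤ e≤ _ _ = begin
  f ^ suc p                              ≤⟨ ^-monoˡ-≤ (suc p) (≤-trans f≤ (*-monoʳ-≤ c suc≤)) ⟩
  (c * (2 * (s ⊔ 1))) ^ suc p            ≡⟨ cong (_^ suc p) (*-assoc c 2 (s ⊔ 1)) ⟨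
  (c * 2 * (s ⊔ 1)) ^ suc p              ≡⟨ ^-distribʳ-* (c * 2) (s ⊔ 1) (suc p) ⟩
  (c * 2) ^ suc p * (s ⊔ 1) ^ suc p      ≤⟨ *-monoʳ-≤ ((c * 2) ^ suc p) (nonzero s (≤-trans s^≤ (^-monoˡ-≤ p e≤))) ⟩
  (c * 2) ^ suc p * (b * n) ^ p          ≡⟨ cong ((c * 2) ^ suc p *_) (^-distribʳ-* b n p) ⟩
  -- The extra factor `b` completes a power with exponent `suc p`, so that the whole constant has
  -- the form `C ^ q` that `_=O[_]^[_/_]` asks for.
  (c * 2) ^ suc p * (b ^ p * n ^ p)      ≤⟨ *-monoʳ-≤ ((c * 2) ^ suc p) (*-monoˡ-≤ (n ^ p) (m≤n*m (b ^ p) b)) ⟩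
  (c * 2) ^ suc p * (b ^ suc p * n ^ p)  ≡⟨ *-assoc ((c * 2) ^ suc p) (b ^ suc p) (n ^ p) ⟨
  (c * 2) ^ suc p * b ^ suc p * n ^ p    ≡⟨ cong (_* n ^ p) (^-distribʳ-* (c * 2) b (suc p)) ⟨
  (c * 2 * b) ^ suc p * n ^ p            ∎
  where
  open ≤-Reasoning

  suc≤ : suc s ≤ 2 * (s ⊔ 1)
  suc≤ = ≤-trans (+-mono-≤ (m≤n⊔m s 1) (m≤m⊔n s 1)) (≤-reflexive (cong (s ⊔ 1 +_) (sym (+-identityʳ _))))

  nonzero : ∀ s → s ^ suc p ≤ (b * n) ^ p → (s ⊔ 1) ^ suc p ≤ (b * n) ^ p
  nonzero zero    _   = ≤-trans (≤-reflexive (^-zeroˡ (suc p))) (m^n>0 (b * n) {{m*n≢0 b n}} p)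
  nonzero (suc s) s^≤ = subst (λ r → suc r ^ suc p ≤ (b * n) ^ p) (sym (⊔-identityʳ s)) s^≤

foldr-⊔≤ : ∀ {A : Set} {f : A → ℕ} {b} xs → (∀ x → f x ≤ b) → foldr _⊔_ 0 (List.map f xs) ≤ b
foldr-⊔≤ []       f≤b = z≤n
foldr-⊔≤ (x ∷ xs) f≤b = ⊔-lub (f≤b x) (foldr-⊔≤ xs f≤b)

sum-map-bounded : ∀ {A : Set} {f : A → ℕ} {b} xs → (∀ x → f x ≤ b) → sum (List.map f xs) ≤ length xs * b
sum-map-bounded []       f≤b = z≤n
sum-map-bounded (x ∷ xs) f≤b = +-mono-≤ (f≤b x) (sum-map-bounded xs f≤b)

-- A rate is a factor of n, or of n + m, in a linear bound.  The rates of
-- partialBFS and weighting are their running times for n = 1.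
descentRate : ℕ → ℕ → ℕ → ℕ
descentRate d K i = 2 + i * suc (gradSampleTime d * suc K + 2)

-- A common bound for the rates of all entries of `limit`, which are at most 2, `suc k` or `d`.
arrayRate : ℕ → ℕ → ℕ
arrayRate d K = 3 + (K + d)

-- There are 16 arrays for each kind of word. The neighbourhood size enters the programs only
-- through literals, whose size is 1, so the register counts reduce to the same number for every
-- `k`, and 0 stands for all.
spaceRate : ℕ → ℕ → ℕ → ℕ → ℕ
spaceRate d K steps t = 16 * arrayRate d K + 16 * arrayRate d K + registers (partialBFS 0)
  + registers (weighting 0 steps) + registers prepare + registers (gradSamples d t)

-- Bounds for a single instance

module Executions (ℛ : Reals) (constants : Constants ℛ) (d t steps K : ℕ)
  (x : SL-GUMAP.Instance ℛ constants d t steps K) (1≤n : 1 ≤ SL-GUMAP.Instance.n x) where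

  open SL-GUMAP.Instance x
  open Graph graph using (neighbours; edges)
  open Semantics ℛ constants ω

  private
    lists : List (List ℕ)
    lists = List.map (λ u → List.map toℕ (neighbours u)) (allFin n)

    degrees : List.map (λ u → length (neighbours u)) (allFin n) ≡ List.map length lists
    degrees = trans (map-cong (λ u → sym (length-map toℕ (neighbours u))) (allFin n)) (map-∘ (allFin n))

    L : ℕ
    L = length adjacencies

    L≤ : L ≤ 2 * m
    L≤ = begin
      length (concat lists)        ≡⟨ length-concat lists ⟩
      sum (List.map length lists)  ≡⟨ cong sum degrees ⟨
      sum (List.map (λ u → length (neighbours u)) (allFin n))
        ≤⟨ sum-degrees graph edges (Unique.allFin⁺ n) ⟩
      2 * m                        ∎
      where open ≤-Reasoning

  open Invariants n k L (starts lists) (starts-suc lists) (starts≤length lists) using (Adjacency; Endpoints)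
  open Programs ℛ constants ω d steps K n k L k≤kmax (starts lists) (starts-suc lists) (starts≤length lists)
    using (limit; row; IndexedRows; Indexed; PreparedRows; Prepared; ready; Ready;
           partialBFS-correct; weighting-correct; prepare-correct; gradSample-correct; gradSamples-correct)
  open WeakestPreconditions ℛ constants ω limit using (Within; Meets; executing; time≤; extents≤; result)

  private
    adjacency-input : Adjacency (row order (cell input)) (row offset (cell input)) (row adjacency (cell input))
    adjacency-input = record
      { order≡    = refl
      ; offset≡   = λ u → cong (sum ∘ take u) degrees
      ; below     = all-at {P = _< n} (All.concat⁺ (All.map⁺ (All.universal
                      (λ u → All.map⁺ (All.universal Fin.toℕ<n (neighbours u))) (allFin n))))
      ; separated = λ u (≤i , i<) (≤j , j<) → at-concat-injective lists (All.map⁺ (All.universal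
                      (λ u → Unique.map⁺ Fin.toℕ-injective (neighbours-unique graph u)) (allFin n))) u ≤i i< ≤j j<
      }
      where open Layout ℛ constants d t steps K x

    within-input : Within (extent input)
    within-input nat  Fin.zero                        = ≤-refl
    within-input nat  (Fin.suc Fin.zero)              = ≤-refl
    within-input nat  (Fin.suc (Fin.suc Fin.zero))    = ≤-refl
    within-input nat  (Fin.suc (Fin.suc (Fin.suc _))) = z≤n
    within-input real _                               = z≤n

    bfs : Meets (partialBFSTime K n) (λ _ c → Indexed (row edgeCount c 0) c) searched
    bfs = executing (partialBFS k) input (partialBFS-correct {cell input} adjacency-input) within-input

    E s : ℕ
    E = row edgeCount (cell (memory searched)) 0

    E≤ : E ≤ k * n
    E≤ = IndexedRows.E≤ (bfs .result)

    E≤K : E ≤ K * n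
    E≤K = ≤-trans E≤ (*-monoˡ-≤ n k≤kmax)

    weights : Meets (weightingTime K steps n) (λ _ → Indexed E) weighted
    weights = executing (weighting k steps) (memory searched) (weighting-correct (bfs .result)) (bfs .extents≤)

    within-initialize : ∀ {μ} → Within (extent μ) → Within (extent (initialize μ))
    within-initialize within nat  a = within nat a
    within-initialize within real a with a Fin.≟ Array.name layout
    ... | yes refl = ≤-refl
    ... | no  _    = within real a

    preparation : Meets (prepareTime (K * n)) (λ _ → Prepared E) prepared
    preparation = executing prepare (initialize (memory weighted))
      (prepare-correct E≤ (IndexedRows.edgeCount≡ (weights .result) , IndexedRows.ends (weights .result)))
      (within-initialize {memory weighted} (weights .extents≤))

    s = row sampleSize (cell (memory prepared)) 0

    open PreparedRows (preparation .result) using (edgeCount≡; ends; sample≤; power≤)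

    start-ready : Ready E s (cell (memory prepared))
    start-ready = ready edgeCount≡ refl ends

    descent : ∀ i → Meets (2 + i * suc (gradSampleTime d * suc s + 2)) (λ _ → Ready E s) (descended i)
    descent i = executing (gradSamples d i) (memory prepared)
      (gradSamples-correct i E≤ start-ready) (preparation .extents≤)

    one-round : ∀ i → Meets (gradSampleTime d * suc s) (λ _ → Ready E s) (round i)
    one-round i = executing (gradSample d (lit i)) (memory (descended i))
      (gradSample-correct {round = lit i} E≤ ≤-refl (descent i .result)) (descent i .extents≤)

    open Linearity 1≤n

    suc-s-linear : Linear (suc s) (suc K)
    suc-s-linear = constant 1 +ᴸ at-most sample≤ (linear E≤K)

    searched-linear : Linear (time searched) (partialBFSTime K 1)
    searched-linear = at-most (bfs .time≤) (constant 6 +ᴸ (variable-linear ᴸ* _ +ᴸ constant 3))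

    weighted-linear : Linear (time weighted) (weightingTime K steps 1)
    weighted-linear = at-most (weights .time≤) (constant 3 +ᴸ variable-linear ᴸ* _)

    prepared-linear : Linear (time prepared) (prepareTime K)
    prepared-linear = at-most (preparation .time≤)
      (constant 3 +ᴸ (Kn ᴸ* 29 +ᴸ (constant 4 +ᴸ (Kn ᴸ* 52 +ᴸ constant 3))))
      where
      Kn : Linear (K * n) K
      Kn = linear ≤-refl

    descended-linear : Linear (time (descended t)) (descentRate d K t)
    descended-linear = at-most (descent t .time≤)
      (constant 2 +ᴸ t *ᴸ (constant 1 +ᴸ (gradSampleTime d *ᴸ suc-s-linear +ᴸ constant 2)))

  C0-linear : time-C0 ≤ partialBFSTime K 1 * n
  C0-linear = holds {a = partialBFSTime K 1} searched-linear

  C1-linear : time-C1 ≤ (partialBFSTime K 1 + weightingTime K steps 1) * n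
  C1-linear = holds {a = partialBFSTime K 1 + weightingTime K steps 1} (searched-linear +ᴸ weighted-linear)

  total-linear : totalTime ≤ (partialBFSTime K 1 + weightingTime K steps 1 + prepareTime K + descentRate d K t) * n
  total-linear = holds {a = partialBFSTime K 1 + weightingTime K steps 1 + prepareTime K + descentRate d K t}
    (searched-linear +ᴸ weighted-linear +ᴸ prepared-linear +ᴸ descended-linear)

  -- `Ready` fixes the sample size `s`, so one bound holds for all rounds and hence for their
  -- maximum. The factor is `suc K` rather than `K` because `power-bound` needs it positive, also
  -- for `K = 0`.
  C2-sublinear : time-C2 ^ 10 ≤ (gradSampleTime d * 2 * suc K) ^ 10 * n ^ 9
  C2-sublinear =
    power-bound 9 {time-C2} {gradSampleTime d} {s} {E} {suc K} {n}
      (foldr-⊔≤ {f = λ i → time (round i)} (upTo t) (λ i → one-round i .time≤))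
      power≤ (≤-trans E≤K (*-monoˡ-≤ n (n≤1+n K))) (s≤s z≤n) 1≤n

  private
    N S : ℕ
    N = n + m
    S = arrayRate d K

    module Size = Linearity {N} (≤-trans 1≤n (m≤m+n n m))
    open Size using () renaming (_+ᴸ_ to _+ˢ_)

    within-limit : ∀ {f a} → a ≤ S → Size.Linear f a → f ≤ S * N
    within-limit a≤ f≤ = ≤-trans (Size.holds f≤) (*-monoˡ-≤ N a≤)

    limit≤ : ∀ w a → limit w a ≤ S * N
    limit≤ = λ
      { nat  → Vec.lookup⁺ {P = _≤ S * N}
          (one ∷ n+1 ∷ 2m ∷ k+1 ∷ k+1 ∷ one ∷ one ∷ one ∷
           kn ∷ kn ∷ kn ∷ n+1 ∷ one ∷ one ∷ one ∷ z≤n ∷ [])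
      ; real → Vec.lookup⁺ {P = _≤ S * N}
          (kn ∷ one ∷ one ∷ one ∷ one ∷ nd ∷ z≤n ∷ z≤n ∷
           z≤n ∷ z≤n ∷ z≤n ∷ z≤n ∷ z≤n ∷ z≤n ∷ z≤n ∷ z≤n ∷ [])
      }
      where
      order-linear : Size.Linear n 1
      order-linear = Size.at-most (m≤m+n n m) Size.variable-linear

      k≤S : k ≤ K + d
      k≤S = m≤n⇒m≤n+o d k≤kmax

      one : 1 ≤ S * N
      one = within-limit (s≤s z≤n) (Size.constant 1)

      n+1 : suc n ≤ S * N
      n+1 = within-limit (s≤s (s≤s z≤n)) (Size.constant 1 +ˢ order-linear)

      2m : L ≤ S * N
      2m = within-limit (s≤s (s≤s z≤n)) (Size.linear (≤-trans L≤ (*-monoʳ-≤ 2 (m≤n+m m n))))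

      k+1 : suc k ≤ S * N
      k+1 = within-limit (s≤s (m≤n⇒m≤o+n 2 k≤S)) (Size.constant (suc k))

      kn : k * n ≤ S * N
      kn = within-limit (m≤n⇒m≤o+n 3 k≤S) (Size.linear (*-monoʳ-≤ k (m≤m+n n m)))

      nd : n * d ≤ S * N
      nd = within-limit (m≤n⇒m≤o+n 3 (m≤n+m d K))
        (Size.linear (≤-trans (≤-reflexive (*-comm n d)) (*-monoʳ-≤ d (m≤m+n n m))))

    extents-linear : ∀ w → Size.Linear (sum (List.map (extent (memory (descended t)) w) (allFin 16))) (16 * S)
    extents-linear w = Size.at-most
      (sum-map-bounded (allFin 16) (λ a → ≤-trans (descent t .extents≤ w a) (limit≤ w a)))
      (16 Size.*ᴸ Size.linear {a = S} ≤-refl)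

  space-linear : totalSpace ≤ spaceRate d K steps t * N
  space-linear = Size.holds {a = spaceRate d K steps t}
    (extents-linear nat +ˢ extents-linear real +ˢ Size.constant (registers (partialBFS 0)) +ˢ
     Size.constant (registers (weighting 0 steps)) +ˢ Size.constant (registers prepare) +ˢ
     Size.constant (registers (gradSamples d t)))

theorem3 : (ℛ : Reals) (constants : Constants ℛ) (d t steps kmax : ℕ) →
    let open SL-GUMAP ℛ constants d t steps kmax in
    (totalTime =O[ n ]) ×
    (time-C0 =O[ n ]) ×
    (time-C1 =O[ n ]) ×
    (time-C2 =O[ n ]^[ 9 / 10 ]) ×
    (totalSpace =O[ (λ x → n x + m x) ])
theorem3 ℛ constants d t steps kmax =
  (partialBFSTime kmax 1 + weightingTime kmax steps 1 + prepareTime kmax + descentRate d kmax t ,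
   1 , Execution.total-linear) ,
  (partialBFSTime kmax 1 , 1 , Execution.C0-linear) ,
  (partialBFSTime kmax 1 + weightingTime kmax steps 1 , 1 , Execution.C1-linear) ,
  (gradSampleTime d * 2 * suc kmax , 1 , Execution.C2-sublinear) ,
  (spaceRate d kmax steps t , 1 , Execution.space-linear)
  where
  module Execution = Executions ℛ constants d t steps kmax
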